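{- Let $q$ be a prime power, and let $n\ge\ell\ge 0$ be integers. Let $\mathcal F\subseteq\mathbb F_q[x]$ be an $\ell$-intersecting family of monic polynomials of degree $n$ of maximum possible size (namely $q^{n-\ell}$) which is primary and non-trivial. Then either $q=2$, $\ell=1$, $n=3$ and $\mathcal F=\{x^2(x+1),\ x(x+1)^2,\ x(x^2+x+1),\ (x+1)(x^2+x+1)\}$, or there is a positive integer $d$ such that \[ \mathcal F=\mathcal F_d:=\left\{\frac{H_d}{p} : p\in\mathbb F_q[x] \text{ monic}, \deg(p)=d\right\}, \] where $H_d$ is the monic least common multiple of all polynomials of degree $d$ over $\mathbb F_q$.
   Context: $\mathbb F_q$ is the finite field with $q$ elements. A family $\mathcal F\subseteq\mathbb F_q[x]$ is $\ell$-intersecting if $\deg(\gcd(p_1,p_2))\geq\ell$ for all $p_1,p_2\in\mathcal F$. Such a maximum-size family of monic degree-$n$ polynomials is called trivial if there is a monic $g$ of degree $\ell$ with $\mathcal F=\{g\cdot p: p \text{ monic}, \deg(p)=n-\ell\}$, and non-trivial otherwise. It is called primary if no non-unit polynomial divides every element of $\mathcal F$. -}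

module Defs where

open import Level using (Level; _⊔_) renaming (suc to lsuc)
open import Data.Nat using (ℕ; zero; suc; _≤_; _∸_)
open import Data.Fin using (Fin)
open import Data.List using (List; []; _∷_; map; _++_; [_])
open import Data.Vec using (Vec; toList)
open import Data.List.Relation.Unary.Any using (Any)
open import Data.List.Relation.Unary.AllPairs using (AllPairs)
open import Data.Product using (Σ; ∃; _×_)
open import Relation.Nullary using (¬_)
open import Relation.Binary.PropositionalEquality using (_≡_)
open import Algebra.Bundles using (CommutativeRing)

record FiniteField (q : ℕ) (c ℓ : Level) : Set (lsuc (c ⊔ ℓ)) where
  field
    commRing : CommutativeRing c ℓ
  open CommutativeRing commRing public hiding (ring)
  field
    1≉0       : ¬ (1# ≈ 0#)
    inverse   : ∀ x → ¬ (x ≈ 0#) → ∃ λ y → (x * y) ≈ 1#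
    enum      : Fin q → Carrier
    enum-inj  : ∀ i j → enum i ≈ enum j → i ≡ j
    enum-surj : ∀ x → ∃ λ i → enum i ≈ x

module Poly {q : ℕ} {c ℓ : Level} (F : FiniteField q c ℓ) where
  open FiniteField F

  -- coefficient lists, lowest degree first
  Poly : Set c
  Poly = List Carrier

  coeff : Poly → ℕ → Carrier
  coeff []      _       = 0#
  coeff (a ∷ p) zero    = a
  coeff (a ∷ p) (suc i) = coeff p i

  -- equality of polynomials: all coefficients agree (trailing zeros ignored)
  _≈P_ : Poly → Poly → Set ℓ
  p ≈P r = ∀ i → coeff p i ≈ coeff r i

  _+P_ : Poly → Poly → Poly
  []      +P r       = r
  (a ∷ p) +P []      = a ∷ p
  (a ∷ p) +P (b ∷ r) = (a + b) ∷ (p +P r)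

  _*P_ : Poly → Poly → Poly
  []      *P r = []
  (a ∷ p) *P r = map (a *_) r +P (0# ∷ (p *P r))

  _∣P_ : Poly → Poly → Set (c ⊔ ℓ)
  g ∣P p = ∃ λ h → (g *P h) ≈P p

  -- monic polynomials of degree n: the n lower coefficients
  Monic : ℕ → Set c
  Monic n = Vec Carrier n

  ⟦_⟧ : ∀ {n} → Monic n → Poly
  ⟦ v ⟧ = toList v ++ [ 1# ]

  _≈M_ : ∀ {n} → Monic n → Monic n → Set ℓ
  u ≈M v = ⟦ u ⟧ ≈P ⟦ v ⟧

  -- a family of monic degree-n polynomials, given as a duplicate-free list
  _∈F_ : ∀ {n} → Monic n → List (Monic n) → Set (c ⊔ ℓ)
  f ∈F Fam = Any (λ g → f ≈M g) Fam

  NoDup : ∀ {n} → List (Monic n) → Set (c ⊔ ℓ)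
  NoDup Fam = AllPairs (λ a b → ¬ (a ≈M b)) Fam

  GcdDeg≥ : Poly → Poly → ℕ → Set (c ⊔ ℓ)
  GcdDeg≥ p₁ p₂ l = ∃ λ k → l ≤ k × Σ (Monic k) λ g → (⟦ g ⟧ ∣P p₁) × (⟦ g ⟧ ∣P p₂)

  Intersecting : ∀ {n} → ℕ → List (Monic n) → Set (c ⊔ ℓ)
  Intersecting l Fam = ∀ p₁ p₂ → p₁ ∈F Fam → p₂ ∈F Fam → GcdDeg≥ ⟦ p₁ ⟧ ⟦ p₂ ⟧ l

  _≐_ : ∀ {n} {a} → List (Monic n) → (Monic n → Set a) → Set (c ⊔ ℓ ⊔ a)
  Fam ≐ P = ∀ f → (f ∈F Fam → P f) × (P f → f ∈F Fam)

  Trivial : ∀ {n} → ℕ → List (Monic n) → Set (c ⊔ ℓ)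
  Trivial {n} l Fam = Σ (Monic l) λ g →
    Fam ≐ (λ f → Σ (Monic (n ∸ l)) λ p → (⟦ g ⟧ *P ⟦ p ⟧) ≈P ⟦ f ⟧)

  -- primary: no non-unit polynomial divides every member.  (Non-units are 0,
  -- which divides no monic polynomial, and nonconstant polynomials, which are
  -- associates of monic ones of degree ≥ 1.)
  Primary : ∀ {n} → List (Monic n) → Set (c ⊔ ℓ)
  Primary Fam = ∀ k → 1 ≤ k → (g : Monic k) → ¬ (∀ f → f ∈F Fam → ⟦ g ⟧ ∣P ⟦ f ⟧)

  IsLcmDeg : ℕ → Poly → Set (c ⊔ ℓ)
  IsLcmDeg d H = (∀ (p : Monic d) → ⟦ p ⟧ ∣P H)
               × (∀ M → (∀ (p : Monic d) → ⟦ p ⟧ ∣P M) → H ∣P M)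

  IsFd : ∀ {n} → ℕ → List (Monic n) → Set (c ⊔ ℓ)
  IsFd d Fam = ∃ λ m → Σ (Monic m) λ H → IsLcmDeg d ⟦ H ⟧ ×
    Fam ≐ (λ f → Σ (Monic d) λ p → (⟦ p ⟧ *P ⟦ f ⟧) ≈P ⟦ H ⟧)

  X X+1 X²+X+1 : Poly
  X = 0# ∷ 1# ∷ []
  X+1 = 1# ∷ 1# ∷ []
  X²+X+1 = 1# ∷ 1# ∷ 1# ∷ []

  Exceptional : Poly → Set ℓ
  Exceptional f =
      (f ≈P ((X *P X) *P X+1))
    ⊎ (f ≈P (X *P (X+1 *P X+1)))
    ⊎ (f ≈P (X *P X²+X+1))
    ⊎ (f ≈P (X+1 *P X²+X+1))
    where open import Data.Sum using (_⊎_)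

{-# OPTIONS --safe #-}
module Submission where

-- Put m = n − l and choose an irreducible P of degree m.  Members of the family congruent
-- modulo P and prime to P coincide, so if P divided no member, the q^m members would
-- occupy all residue classes but zero; hence P divides some member, and by primarity not
-- every one.  If P ∣ f₁ and P ∤ f₀, then a common divisor of degree ≥ l of f₁ and f₀ is
-- prime to P, which forces it to be f₁/P, of degree l.  So every h = f₁/P divides every f₀.
-- A single h would divide the whole family.  If there is a single f₀, then dividing P f₀
-- by the members yields q^m distinct monic polynomials of degree m, that is, all of them.
-- Otherwise the lcm of two h's and the gcd of two f₀'s show that each of the two kinds has
-- at most q^(m-1) members, so q = 2 and both bounds are attained; this leads to m = 2 and
-- the exceptional family.
--
-- Irreducibles of degree m exist by counting: summing deg P over all prime powers P^i
-- dividing f gives deg f, and summing this over all monic f of degree n, for n and n − 1,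
-- gives ∑ deg P = q^n over the pairs (P, i) with i · deg P = n.  Smaller degrees can
-- contribute at most q + ⋯ + q^(n-1) < q^n to this sum.

open import Defs
open import Level using (Level; _⊔_)
open import Data.Nat as ℕ using (ℕ; zero; suc; _≤_; _<_; z≤n; s≤s; _^_; _∸_)
import Data.Nat.Properties as ℕ
open import Data.Nat.Induction using (<-rec)
open import Data.Fin using (Fin; zero; suc)
import Data.Fin.Properties as Fin
open import Data.List as List
  using (List; []; _∷_; map; [_]; length; _++_; filter; allFin; cartesianProductWith)
import Data.List.Properties as List
open import Data.List.Relation.Unary.Any as Any using (Any; here; there)
import Data.List.Relation.Unary.Any.Properties as Any
open import Data.List.Relation.Unary.All as All using (All; []; _∷_)
open import Data.List.Relation.Unary.AllPairs as AllPairs using ([]; _∷_)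
import Data.List.Relation.Unary.AllPairs.Properties as AllPairs
open import Data.List.Relation.Unary.Unique.Propositional using (Unique)
import Data.List.Relation.Unary.Unique.Propositional.Properties as Unique
open import Data.List.Membership.Propositional using (_∈_; find; lose)
open import Data.List.Membership.Propositional.Properties
  using (∈-∃++; ∈-++⁻; ∈-++⁺ˡ; ∈-++⁺ʳ; ∈-map⁺; ∈-map⁻; ∈-filter⁺; ∈-filter⁻; ∈-allFin; ∈-cartesianProductWith⁺)
open import Data.Vec as V using (Vec; []; _∷_)
import Data.Vec.Properties as Vec
open import Data.Product using (Σ; ∃; ∃₂; _×_; _,_; proj₁; proj₂)
open import Data.Sum using (_⊎_; inj₁; inj₂)
open import Function using (_∘_)
open import Relation.Nullary using (¬_; Dec; yes; no; contradiction; ¬?; _×-dec_)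
open import Relation.Nullary.Decidable using (map′; decidable-stable)
open import Relation.Binary.PropositionalEquality as ≡ using (_≡_; _≢_)
open import Relation.Binary.Definitions using (DecidableEquality)
open import Relation.Unary using (Decidable)
open import Algebra.Bundles using (CommutativeRing)
import Algebra.Properties.CommutativeSemigroup as CommutativeSemigroupProperties
import Algebra.Properties.Group as GroupProperties
import Algebra.Properties.AbelianGroup as AbelianGroupProperties
import Algebra.Properties.Ring as RingProperties
import Algebra.Properties.Semiring.Divisibility as SemiringDivisibility
import Algebra.Solver.Ring.NaturalCoefficients.Default as SemiringSolver
import Relation.Binary.Reasoning.Setoid as SetoidReasoning

-- The degree m of P serves two ends. There are exactly q^m residue classes modulo P, as many as
-- there are members; and if g is a common divisor of degree at least l prime to P, then P g has
-- degree at least n, too large to divide a nonzero difference of two monic polynomials of degree n.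
-- Most exact statements are obtained by counting: an injective correspondence between two lists of
-- equal length is onto, which produces a member with a prescribed residue or a prescribed quotient
-- without constructing it. Equality of polynomials ignores trailing zeros and coefficients live in
-- a setoid, so this counting is carried out on vectors over `Fin q`, where equality is
-- propositional and decidable. In the case of a single f₀ the integer d is m and H_d is P f₀. That
-- P f₀ is a common multiple comes from counting; that it is the least one comes from primarity. In
-- the exceptional case primarity is what fixes l.

-- The ring of polynomials on coefficient lists.

module PolyRing {q : ℕ} {c ℓ : Level} (F : FiniteField q c ℓ) where
  open FiniteField F
  open Poly F
  open SetoidReasoning setoid
  open CommutativeSemigroupProperties (CommutativeRing.+-commutativeSemigroup commRing)
    using (interchange)
  private
    module RP = RingProperties (CommutativeRing.ring commRing)

  idx : Carrier → Fin q
  idx x = proj₁ (enum-surj x)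

  enum-idx : ∀ x → enum (idx x) ≈ x
  enum-idx x = proj₂ (enum-surj x)

  idx-cong : ∀ {x y} → x ≈ y → idx x ≡ idx y
  idx-cong x≈y = enum-inj _ _ (trans (enum-idx _) (trans x≈y (sym (enum-idx _))))

  idx-injective : ∀ {x y} → idx x ≡ idx y → x ≈ y
  idx-injective eq = trans (sym (enum-idx _)) (trans (reflexive (≡.cong enum eq)) (enum-idx _))

  infix 4 _≈?_
  _≈?_ : ∀ x y → Dec (x ≈ y)
  x ≈? y with idx x Fin.≟ idx y
  ... | yes eq = yes (idx-injective eq)
  ... | no ne  = no λ x≈y → ne (idx-cong x≈y)

  -- _≈P_ unfolds to a Π-type from which the two polynomials cannot be inferred;
  -- the record makes them inferable.
  infix 4 _≋_
  record _≋_ (p r : Poly) : Set ℓ where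
    constructor mk
    field at : p ≈P r
  open _≋_ public

  ≋-refl : ∀ {p} → p ≋ p
  ≋-refl = mk λ _ → refl

  ≋-sym : ∀ {p r} → p ≋ r → r ≋ p
  ≋-sym e = mk λ i → sym (at e i)

  ≋-trans : ∀ {p r s} → p ≋ r → r ≋ s → p ≋ s
  ≋-trans e e' = mk λ i → trans (at e i) (at e' i)

  infixr 7 _·_
  _·_ : Carrier → Poly → Poly
  a · r = map (a *_) r

  -P_ : Poly → Poly
  -P_ = map (λ a → - a)

  coeff-+ : ∀ p r i → coeff (p +P r) i ≈ coeff p i + coeff r i
  coeff-+ []      r       i       = sym (+-identityˡ _)
  coeff-+ (a ∷ p) []      i       = sym (+-identityʳ _)
  coeff-+ (a ∷ p) (b ∷ r) zero    = refl
  coeff-+ (a ∷ p) (b ∷ r) (suc i) = coeff-+ p r i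

  coeff-· : ∀ a r i → coeff (a · r) i ≈ a * coeff r i
  coeff-· a []      i       = sym (zeroʳ a)
  coeff-· a (b ∷ r) zero    = refl
  coeff-· a (b ∷ r) (suc i) = coeff-· a r i

  coeff-neg : ∀ r i → coeff (-P r) i ≈ - coeff r i
  coeff-neg []      i       = sym RP.-0#≈0#
  coeff-neg (b ∷ r) zero    = refl
  coeff-neg (b ∷ r) (suc i) = coeff-neg r i

  ∷-cong : ∀ {a b p r} → a ≈ b → p ≋ r → (a ∷ p) ≋ (b ∷ r)
  ∷-cong a≈b e = mk λ { zero → a≈b ; (suc i) → at e i }

  tail-≋ : ∀ {a b p r} → (a ∷ p) ≋ (b ∷ r) → p ≋ r
  tail-≋ e = mk λ i → at e (suc i)

  +P-cong : ∀ {p p' r r'} → p ≋ p' → r ≋ r' → (p +P r) ≋ (p' +P r')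
  +P-cong {p} {p'} {r} {r'} e e' = mk λ i → begin
    coeff (p +P r) i        ≈⟨ coeff-+ p r i ⟩
    coeff p i + coeff r i   ≈⟨ +-cong (at e i) (at e' i) ⟩
    coeff p' i + coeff r' i ≈⟨ coeff-+ p' r' i ⟨
    coeff (p' +P r') i      ∎

  +P-comm : ∀ p r → (p +P r) ≋ (r +P p)
  +P-comm p r = mk λ i → begin
    coeff (p +P r) i      ≈⟨ coeff-+ p r i ⟩
    coeff p i + coeff r i ≈⟨ +-comm _ _ ⟩
    coeff r i + coeff p i ≈⟨ coeff-+ r p i ⟨
    coeff (r +P p) i      ∎

  +P-assoc : ∀ p r s → ((p +P r) +P s) ≋ (p +P (r +P s))
  +P-assoc p r s = mk λ i → begin
    coeff ((p +P r) +P s) i             ≈⟨ coeff-+ (p +P r) s i ⟩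
    coeff (p +P r) i + coeff s i        ≈⟨ +-congʳ (coeff-+ p r i) ⟩
    (coeff p i + coeff r i) + coeff s i ≈⟨ +-assoc _ _ _ ⟩
    coeff p i + (coeff r i + coeff s i) ≈⟨ +-congˡ (coeff-+ r s i) ⟨
    coeff p i + coeff (r +P s) i        ≈⟨ coeff-+ p (r +P s) i ⟨
    coeff (p +P (r +P s)) i             ∎

  +P-identityʳ : ∀ p → (p +P []) ≋ p
  +P-identityʳ p = ≋-trans (+P-comm p []) ≋-refl

  -P-cong : ∀ {p r} → p ≋ r → (-P p) ≋ (-P r)
  -P-cong {p} {r} e = mk λ i → trans (coeff-neg p i) (trans (-‿cong (at e i)) (sym (coeff-neg r i)))

  -P-inverseʳ : ∀ p → (p +P (-P p)) ≋ []
  -P-inverseʳ p = mk λ i → begin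
    coeff (p +P (-P p)) i      ≈⟨ coeff-+ p (-P p) i ⟩
    coeff p i + coeff (-P p) i ≈⟨ +-congˡ (coeff-neg p i) ⟩
    coeff p i + - coeff p i    ≈⟨ -‿inverseʳ _ ⟩
    0#                         ∎

  -P-inverseˡ : ∀ p → ((-P p) +P p) ≋ []
  -P-inverseˡ p = ≋-trans (+P-comm (-P p) p) (-P-inverseʳ p)

  +P-interchange : ∀ p r s t → ((p +P r) +P (s +P t)) ≋ ((p +P s) +P (r +P t))
  +P-interchange p r s t = mk λ i → begin
    coeff ((p +P r) +P (s +P t)) i                    ≈⟨ expand p r s t i ⟩
    (coeff p i + coeff r i) + (coeff s i + coeff t i) ≈⟨ interchange _ _ _ _ ⟩
    (coeff p i + coeff s i) + (coeff r i + coeff t i) ≈⟨ expand p s r t i ⟨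
    coeff ((p +P s) +P (r +P t)) i                    ∎
    where
    expand : ∀ p r s t i → coeff ((p +P r) +P (s +P t)) i ≈ (coeff p i + coeff r i) + (coeff s i + coeff t i)
    expand p r s t i = trans (coeff-+ (p +P r) (s +P t) i) (+-cong (coeff-+ p r i) (coeff-+ s t i))

  +P-swap : ∀ p r s → (p +P (r +P s)) ≋ (r +P (p +P s))
  +P-swap p r s = ≋-trans (≋-sym (+P-assoc p r s))
    (≋-trans (+P-cong (+P-comm p r) ≋-refl) (+P-assoc r p s))

  ·-cong : ∀ {a b r s} → a ≈ b → r ≋ s → (a · r) ≋ (b · s)
  ·-cong {a} {b} {r} {s} a≈b e =
    mk λ i → trans (coeff-· a r i) (trans (*-cong a≈b (at e i)) (sym (coeff-· b s i)))

  ·-distrib-+ : ∀ a r s → (a · (r +P s)) ≋ ((a · r) +P (a · s))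
  ·-distrib-+ a r s = mk λ i → begin
    coeff (a · (r +P s)) i              ≈⟨ coeff-· a (r +P s) i ⟩
    a * coeff (r +P s) i                ≈⟨ *-congˡ (coeff-+ r s i) ⟩
    a * (coeff r i + coeff s i)         ≈⟨ distribˡ _ _ _ ⟩
    a * coeff r i + a * coeff s i       ≈⟨ +-cong (coeff-· a r i) (coeff-· a s i) ⟨
    coeff (a · r) i + coeff (a · s) i   ≈⟨ coeff-+ (a · r) (a · s) i ⟨
    coeff ((a · r) +P (a · s)) i        ∎

  ·-assoc : ∀ a b r → ((a * b) · r) ≋ (a · b · r)
  ·-assoc a b r = mk λ i → begin
    coeff ((a * b) · r) i  ≈⟨ coeff-· (a * b) r i ⟩
    (a * b) * coeff r i    ≈⟨ *-assoc _ _ _ ⟩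
    a * (b * coeff r i)    ≈⟨ *-congˡ (coeff-· b r i) ⟨
    a * coeff (b · r) i    ≈⟨ coeff-· a (b · r) i ⟨
    coeff (a · b · r) i    ∎

  0·-zero : ∀ {a} r → a ≈ 0# → (a · r) ≋ []
  0·-zero {a} r a≈0 = mk λ i → trans (coeff-· a r i) (trans (*-congʳ a≈0) (zeroˡ _))

  1·-identity : ∀ r → (1# · r) ≋ r
  1·-identity r = mk λ i → trans (coeff-· 1# r i) (*-identityˡ _)

  0∷[] : (0# ∷ []) ≋ []
  0∷[] = mk λ { zero → refl ; (suc i) → refl }

  *P-congˡ : ∀ p {r s} → r ≋ s → (p *P r) ≋ (p *P s)
  *P-congˡ []      e = ≋-refl
  *P-congˡ (a ∷ p) e = +P-cong (·-cong refl e) (∷-cong refl (*P-congˡ p e))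

  *P-zeroˡ : ∀ p r → p ≋ [] → (p *P r) ≋ []
  *P-zeroˡ []      r e = ≋-refl
  *P-zeroˡ (a ∷ p) r e = +P-cong (0·-zero r (at e 0))
    (≋-trans (∷-cong refl (*P-zeroˡ p r (mk λ i → at e (suc i)))) 0∷[])

  *P-congʳ : ∀ p p' {r} → p ≋ p' → (p *P r) ≋ (p' *P r)
  *P-congʳ []      p'       {r} e = ≋-sym (*P-zeroˡ p' r (≋-sym e))
  *P-congʳ (a ∷ p) []       {r} e = *P-zeroˡ (a ∷ p) r e
  *P-congʳ (a ∷ p) (b ∷ p') {r} e =
    +P-cong (·-cong (at e 0) ≋-refl) (∷-cong refl (*P-congʳ p p' (tail-≋ e)))

  *P-cong : ∀ {p p' r r'} → p ≋ p' → r ≋ r' → (p *P r) ≋ (p' *P r')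
  *P-cong {p} {p'} {r} {r'} e e' = ≋-trans (*P-congʳ p p' e) (*P-congˡ p' e')

  *P-zeroʳ : ∀ p → (p *P []) ≋ []
  *P-zeroʳ []      = ≋-refl
  *P-zeroʳ (a ∷ p) = ≋-trans (∷-cong refl (*P-zeroʳ p)) 0∷[]

  -- The recursion of the product in its second factor, mirroring the defining one in the first; the
  -- two together give commutativity by induction.
  *P-∷ : ∀ p b r → (p *P (b ∷ r)) ≋ ((b · p) +P (0# ∷ (p *P r)))
  *P-∷ []      b r = ≋-sym 0∷[]
  *P-∷ (a ∷ p) b r = ∷-cong (+-congʳ (*-comm a b))
    (≋-trans (+P-cong (≋-refl {a · r}) (*P-∷ p b r)) (+P-swap (a · r) (b · p) (0# ∷ (p *P r))))

  *P-comm : ∀ p r → (p *P r) ≋ (r *P p)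
  *P-comm []      r = ≋-sym (*P-zeroʳ r)
  *P-comm (a ∷ p) r = ≋-trans (+P-cong (≋-refl {a · r}) (∷-cong refl (*P-comm p r))) (≋-sym (*P-∷ r a p))

  *P-distribˡ : ∀ p r s → (p *P (r +P s)) ≋ ((p *P r) +P (p *P s))
  *P-distribˡ []      r s = ≋-refl
  *P-distribˡ (a ∷ p) r s = ≋-trans
    (+P-cong (·-distrib-+ a r s) (∷-cong (sym (+-identityʳ 0#)) (*P-distribˡ p r s)))
    (+P-interchange (a · r) (a · s) (0# ∷ (p *P r)) (0# ∷ (p *P s)))

  *P-distribʳ : ∀ p r s → ((r +P s) *P p) ≋ ((r *P p) +P (s *P p))
  *P-distribʳ p r s = ≋-trans (*P-comm (r +P s) p)
    (≋-trans (*P-distribˡ p r s) (+P-cong (*P-comm p r) (*P-comm p s)))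

  ·-*P : ∀ a r s → ((a · r) *P s) ≋ (a · (r *P s))
  ·-*P a []      s = ≋-refl
  ·-*P a (b ∷ r) s = ≋-trans
    (+P-cong (·-assoc a b s) (∷-cong (sym (zeroʳ a)) (·-*P a r s)))
    (≋-sym (·-distrib-+ a (b · s) (0# ∷ (r *P s))))

  0∷-*P : ∀ p r → ((0# ∷ p) *P r) ≋ (0# ∷ (p *P r))
  0∷-*P p r = +P-cong (0·-zero r refl) ≋-refl

  *P-assoc : ∀ p r s → ((p *P r) *P s) ≋ (p *P (r *P s))
  *P-assoc []      r s = ≋-refl
  *P-assoc (a ∷ p) r s = ≋-trans (*P-distribʳ s (a · r) (0# ∷ (p *P r)))
    (+P-cong (·-*P a r s) (≋-trans (0∷-*P (p *P r) s) (∷-cong refl (*P-assoc p r s))))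

  *P-identityˡ : ∀ p → ([ 1# ] *P p) ≋ p
  *P-identityˡ p = ≋-trans (+P-cong (1·-identity p) 0∷[]) (+P-identityʳ p)

  polyRing : CommutativeRing c ℓ
  polyRing = record
    { Carrier = Poly ; _≈_ = _≋_ ; _+_ = _+P_ ; _*_ = _*P_ ; -_ = -P_ ; 0# = [] ; 1# = [ 1# ]
    ; isCommutativeRing = record
      { isRing = record
        { +-isAbelianGroup = record
          { isGroup = record
            { isMonoid = record
              { isSemigroup = record
                { isMagma = record
                  { isEquivalence = record { refl = ≋-refl ; sym = ≋-sym ; trans = ≋-trans }
                  ; ∙-cong = +P-cong }
                ; assoc = +P-assoc }
              ; identity = (λ _ → ≋-refl) , +P-identityʳ }
            ; inverse = -P-inverseˡ , -P-inverseʳ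
            ; ⁻¹-cong = -P-cong }
          ; comm = +P-comm }
        ; *-cong = *P-cong
        ; *-assoc = *P-assoc
        ; *-identity = *P-identityˡ , λ p → ≋-trans (*P-comm p [ 1# ]) (*P-identityˡ p)
        ; distrib = *P-distribˡ , *P-distribʳ }
      ; *-comm = *P-comm } }

-- Degrees, monic polynomials and division with remainder.

module Degree {q : ℕ} {c ℓ : Level} (F : FiniteField q c ℓ) where
  open FiniteField F
  open Poly F
  open PolyRing F
  open SetoidReasoning setoid
  private
    module R = CommutativeRing polyRing

  -- Degree below `n`, the zero polynomial included. Trailing zeros make the length of a list
  -- useless as a degree, hence a condition on coefficients.
  record Bounded (n : ℕ) (p : Poly) : Set ℓ where
    constructor mk
    field vanish : ∀ i → n ≤ i → coeff p i ≈ 0#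
  open Bounded public

  -- A predicate on arbitrary lists, unlike `Monic`, so that products and quotients can be called
  -- monic as they stand.
  record IsMonic (n : ℕ) (p : Poly) : Set ℓ where
    constructor mk
    field
      lead    : coeff p n ≈ 1#
      bounded : Bounded (suc n) p
  open IsMonic public

  bounded-resp : ∀ {n p r} → p ≋ r → Bounded n p → Bounded n r
  bounded-resp e b = mk λ i n≤i → trans (sym (at e i)) (vanish b i n≤i)

  monic-resp : ∀ {n p r} → p ≋ r → IsMonic n p → IsMonic n r
  monic-resp e m = mk (trans (sym (at e _)) (lead m)) (bounded-resp e (bounded m))

  bounded-mono : ∀ {m n p} → m ≤ n → Bounded m p → Bounded n p
  bounded-mono m≤n b = mk λ i n≤i → vanish b i (ℕ.≤-trans m≤n n≤i)

  bounded-[] : ∀ {n} → Bounded n []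
  bounded-[] = mk λ _ _ → refl

  bounded-+ : ∀ {n p r} → Bounded n p → Bounded n r → Bounded n (p +P r)
  bounded-+ {p = p} {r} b b' = mk λ i n≤i → begin
    coeff (p +P r) i      ≈⟨ coeff-+ p r i ⟩
    coeff p i + coeff r i ≈⟨ +-cong (vanish b i n≤i) (vanish b' i n≤i) ⟩
    0# + 0#               ≈⟨ +-identityˡ 0# ⟩
    0#                    ∎

  bounded-· : ∀ {n r} a → Bounded n r → Bounded n (a · r)
  bounded-· {r = r} a b = mk λ i n≤i → trans (coeff-· a r i) (trans (*-congˡ (vanish b i n≤i)) (zeroʳ a))

  -1·≋-P : ∀ r → ((- 1#) · r) ≋ (-P r)
  -1·≋-P r = mk λ i → begin
    coeff ((- 1#) · r) i ≈⟨ coeff-· (- 1#) r i ⟩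
    - 1# * coeff r i     ≈⟨ -1*x≈-x _ ⟩
    - coeff r i          ≈⟨ coeff-neg r i ⟨
    coeff (-P r) i       ∎
    where open RingProperties (CommutativeRing.ring commRing) using (-1*x≈-x)

  bounded-neg : ∀ {n r} → Bounded n r → Bounded n (-P r)
  bounded-neg b = bounded-resp (-1·≋-P _) (bounded-· (- 1#) b)

  bounded-0∷ : ∀ {n a p} → Bounded n p → Bounded (suc n) (a ∷ p)
  bounded-0∷ b = mk λ { (suc i) (s≤s n≤i) → vanish b i n≤i }

  bounded-tail : ∀ {n a p} → Bounded (suc n) (a ∷ p) → Bounded n p
  bounded-tail b = mk λ i n≤i → vanish b (suc i) (s≤s n≤i)

  bounded-zero : ∀ {p} → Bounded 0 p → p ≋ []
  bounded-zero b = mk λ i → vanish b i z≤n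

  bounded-length : ∀ p → Bounded (length p) p
  bounded-length []      = bounded-[]
  bounded-length (a ∷ p) = bounded-0∷ (bounded-length p)

  bounded-pred : ∀ {n p} → coeff p n ≈ 0# → Bounded (suc n) p → Bounded n p
  bounded-pred {n} {p} z b = mk go
    where
    go : ∀ i → n ≤ i → coeff p i ≈ 0#
    go i n≤i with ℕ.m≤n⇒m<n∨m≡n n≤i
    ... | inj₁ n<i    = vanish b i n<i
    ... | inj₂ ≡.refl = z

  coeff-∷-* : ∀ a p r i → coeff ((a ∷ p) *P r) (suc i) ≈ a * coeff r (suc i) + coeff (p *P r) i
  coeff-∷-* a p r i = trans (coeff-+ (a · r) _ (suc i)) (+-congʳ (coeff-· a r (suc i)))

  bounded-* : ∀ {m n} p {r} → Bounded (suc m) p → Bounded (suc n) r → Bounded (suc (m ℕ.+ n)) (p *P r)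
  bounded-* []      b b' = bounded-[]
  bounded-* {zero} {n} (a ∷ p) {r} b b' = bounded-resp (R.sym a·r) (bounded-· a b')
    where
    a·r : ((a ∷ p) *P r) ≋ (a · r)
    a·r = R.trans (+P-cong ≋-refl
            (R.trans (∷-cong refl (*P-zeroˡ p r (bounded-zero (bounded-tail b)))) 0∷[])) (R.+-identityʳ _)
  bounded-* {suc m} {n} (a ∷ p) {r} b b' = bounded-+
    (bounded-mono (s≤s (ℕ.m≤n+m n (suc m))) (bounded-· a b'))
    (bounded-0∷ (bounded-* p (bounded-tail b) b'))

  lead-* : ∀ {m n} p {r} → Bounded (suc m) p → Bounded (suc n) r →
           coeff (p *P r) (m ℕ.+ n) ≈ coeff p m * coeff r n
  lead-* []      b b' = sym (zeroˡ _)
  lead-* {zero} {n} (a ∷ p) {r} b b' = begin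
    coeff ((a ∷ p) *P r) n                 ≈⟨ coeff-+ (a · r) _ n ⟩
    coeff (a · r) n + coeff (0# ∷ (p *P r)) n
      ≈⟨ +-congˡ (at (R.trans (∷-cong refl (*P-zeroˡ p r (bounded-zero (bounded-tail b)))) 0∷[]) n) ⟩
    coeff (a · r) n + 0#                   ≈⟨ +-identityʳ _ ⟩
    coeff (a · r) n                        ≈⟨ coeff-· a r n ⟩
    a * coeff r n                          ∎
  lead-* {suc m} {n} (a ∷ p) {r} b b' = begin
    coeff ((a ∷ p) *P r) (suc (m ℕ.+ n))                  ≈⟨ coeff-∷-* a p r (m ℕ.+ n) ⟩
    a * coeff r (suc (m ℕ.+ n)) + coeff (p *P r) (m ℕ.+ n)
      ≈⟨ +-cong (trans (*-congˡ (vanish b' _ (s≤s (ℕ.m≤n+m n m)))) (zeroʳ a)) (lead-* p (bounded-tail b) b') ⟩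
    0# + coeff p m * coeff r n                            ≈⟨ +-identityˡ _ ⟩
    coeff p m * coeff r n                                 ∎

  monic-* : ∀ {m n p r} → IsMonic m p → IsMonic n r → IsMonic (m ℕ.+ n) (p *P r)
  monic-* {p = p} mp mr = mk
    (trans (lead-* p (bounded mp) (bounded mr)) (trans (*-cong (lead mp) (lead mr)) (*-identityˡ 1#)))
    (bounded-* p (bounded mp) (bounded mr))

  -- The length of `r` gives some bound, which is then lowered one degree at a time: as `p` is
  -- monic, the top coefficient of `r` reappears as a coefficient of the product, where it vanishes.
  quotient-bounded : ∀ {m n p r} → IsMonic m p → Bounded (m ℕ.+ n) (p *P r) → Bounded n r
  quotient-bounded {m} {n} {p} {r} mp b = descend (length r) (bounded-mono (ℕ.m≤m+n _ n) (bounded-length r))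
    where
    descend : ∀ k → Bounded (k ℕ.+ n) r → Bounded n r
    descend zero    br = br
    descend (suc k) br = descend k (bounded-pred (begin
      coeff r (k ℕ.+ n)                ≈⟨ *-identityˡ _ ⟨
      1# * coeff r (k ℕ.+ n)           ≈⟨ *-congʳ (lead mp) ⟨
      coeff p m * coeff r (k ℕ.+ n)    ≈⟨ lead-* p (bounded mp) br ⟨
      coeff (p *P r) (m ℕ.+ (k ℕ.+ n)) ≈⟨ vanish b _ (ℕ.+-monoʳ-≤ m (ℕ.m≤n+m n k)) ⟩
      0#                               ∎) br)

  quotient-monic : ∀ {m n p r} → IsMonic m p → IsMonic (m ℕ.+ n) (p *P r) → IsMonic n r
  quotient-monic {m} {n} {p} {r} mp mpr = mk (begin
      coeff r n                ≈⟨ *-identityˡ _ ⟨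
      1# * coeff r n           ≈⟨ *-congʳ (lead mp) ⟨
      coeff p m * coeff r n    ≈⟨ lead-* p (bounded mp) br ⟨
      coeff (p *P r) (m ℕ.+ n) ≈⟨ lead mpr ⟩
      1#                       ∎) br
    where
    br : Bounded (suc n) r
    br = quotient-bounded mp (≡.subst (λ k → Bounded k (p *P r)) (≡.sym (ℕ.+-suc m n)) (bounded mpr))

  monic≉0 : ∀ {n p} → IsMonic n p → ¬ p ≋ []
  monic≉0 mp p≋0 = 1≉0 (trans (sym (lead mp)) (at p≋0 _))

  monic-*-zero : ∀ {m p r} → IsMonic m p → (p *P r) ≋ [] → r ≋ []
  monic-*-zero mp e = bounded-zero (quotient-bounded mp (bounded-resp (R.sym e) bounded-[]))

  monic-cancel : ∀ {m p r s} → IsMonic m p → (p *P r) ≋ (p *P s) → r ≋ s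
  monic-cancel {p = p} {r} {s} mp e = x∙y⁻¹≈ε⇒x≈y r s
    (monic-*-zero mp (R.trans (R.distribˡ p r (-P s))
      (R.trans (R.+-cong e (R.sym (-‿distribʳ-* p s))) (R.-‿inverseʳ (p *P s)))))
    where
    open RingProperties R.ring using (-‿distribʳ-*)
    open GroupProperties R.+-group using (x∙y⁻¹≈ε⇒x≈y)

  monic-1 : IsMonic 0 [ 1# ]
  monic-1 = mk refl (mk λ { (suc i) _ → refl })

  monic-0⇒1 : ∀ {p} → IsMonic 0 p → p ≋ [ 1# ]
  monic-0⇒1 mp = mk λ { zero → lead mp ; (suc i) → vanish (bounded mp) (suc i) (s≤s z≤n) }

  monic-divisor-degree : ∀ {m n p r} → IsMonic m p → IsMonic n (p *P r) → m ≤ n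
  monic-divisor-degree {m} {n} {p} {r} mp mpr with m ℕ.≤? n
  ... | yes m≤n = m≤n
  ... | no m≰n  = contradiction (R.trans (*P-congˡ p r≋0) (*P-zeroʳ p)) (monic≉0 mpr)
    where
    r≋0 : r ≋ []
    r≋0 = bounded-zero (quotient-bounded mp (bounded-mono (ℕ.≤-trans (ℕ.≰⇒> m≰n) (ℕ.m≤m+n m 0)) (bounded mpr)))

  monic-quotient : ∀ {m n p r} → IsMonic m p → IsMonic n (p *P r) → IsMonic (n ℕ.∸ m) r
  monic-quotient {m} {n} {p} {r} mp mpr = quotient-monic mp
    (≡.subst (λ k → IsMonic k (p *P r)) (≡.sym (ℕ.m+[n∸m]≡n (monic-divisor-degree mp mpr))) mpr)

  monic-∷ : ∀ {n a p} → IsMonic n p → IsMonic (suc n) (a ∷ p)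
  monic-∷ mp = mk (lead mp) (bounded-0∷ (bounded mp))

  ⟦⟧-monic : ∀ {n} (v : Monic n) → IsMonic n ⟦ v ⟧
  ⟦⟧-monic []      = monic-1
  ⟦⟧-monic (a ∷ v) = monic-∷ (⟦⟧-monic v)

  tl : Poly → Poly
  tl []      = []
  tl (_ ∷ p) = p

  ∷-tl : ∀ p → (coeff p 0 ∷ tl p) ≋ p
  ∷-tl []      = 0∷[]
  ∷-tl (_ ∷ _) = ≋-refl

  monic-tl : ∀ {n p} → IsMonic (suc n) p → IsMonic n (tl p)
  monic-tl {p = []}    mp = contradiction (sym (lead mp)) 1≉0
  monic-tl {p = _ ∷ _} mp = mk (lead mp) (bounded-tail (bounded mp))

  toMonic : ∀ n p → IsMonic n p → ∃ λ (v : Monic n) → ⟦ v ⟧ ≋ p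
  toMonic zero    p mp = [] , ≋-sym (monic-0⇒1 mp)
  toMonic (suc n) p mp with toMonic n (tl p) (monic-tl mp)
  ... | v , e = coeff p 0 ∷ v , R.trans (∷-cong refl e) (∷-tl p)

  -- Division along the coefficient list: p = g s + t gives a + X p = g (X s) + (a + X t), and
  -- subtracting one scalar multiple of `g` removes the coefficient of degree `m`.
  divMod : ∀ {m g} → IsMonic m g → ∀ p → ∃₂ λ s t → p ≋ ((g *P s) +P t) × Bounded m t
  divMod {m} {g} mg []      = [] , [] , R.sym (R.trans (R.+-identityʳ _) (*P-zeroʳ g)) , bounded-[]
  divMod {m} {g} mg (a ∷ p) with divMod mg p
  ... | s , t , e , b = (k ∷ s) , (t' +P (-P (k · g))) , eq , bounded-pred top
        (bounded-+ (bounded-0∷ b) (bounded-neg (bounded-· k (bounded mg))))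
    where
    t' : Poly
    t' = a ∷ t
    k : Carrier
    k = coeff t' m
    top : coeff (t' +P (-P (k · g))) m ≈ 0#
    top = begin
      coeff (t' +P (-P (k · g))) m  ≈⟨ coeff-+ t' (-P (k · g)) m ⟩
      k + coeff (-P (k · g)) m      ≈⟨ +-congˡ (coeff-neg (k · g) m) ⟩
      k + - coeff (k · g) m         ≈⟨ +-congˡ (-‿cong (coeff-· k g m)) ⟩
      k + - (k * coeff g m)         ≈⟨ +-congˡ (-‿cong (trans (*-congˡ (lead mg)) (*-identityʳ k))) ⟩
      k + - k                       ≈⟨ -‿inverseʳ k ⟩
      0#                            ∎
    module RR = SetoidReasoning R.setoid
    eq : (a ∷ p) ≋ ((g *P (k ∷ s)) +P (t' +P (-P (k · g))))
    eq = RR.begin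
      (a ∷ p)                                                RR.≈⟨ ∷-cong (sym (+-identityˡ a)) e ⟩
      ((0# ∷ (g *P s)) +P t')                                RR.≈⟨ R.+-identityʳ _ ⟨
      (((0# ∷ (g *P s)) +P t') +P [])                        RR.≈⟨ R.+-congˡ {(0# ∷ (g *P s)) +P t'} (R.-‿inverseʳ (k · g)) ⟨
      (((0# ∷ (g *P s)) +P t') +P ((k · g) +P (-P (k · g)))) RR.≈⟨ +P-interchange (0# ∷ (g *P s)) t' (k · g) (-P (k · g)) ⟩
      (((0# ∷ (g *P s)) +P (k · g)) +P (t' +P (-P (k · g))))
        RR.≈⟨ R.+-congʳ (R.trans (R.+-comm (0# ∷ (g *P s)) (k · g)) (R.sym (*P-∷ g k s))) ⟩
      ((g *P (k ∷ s)) +P (t' +P (-P (k · g))))               RR.∎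

  ·≋* : ∀ a r → (a · r) ≋ ([ a ] *P r)
  ·≋* a r = R.sym (R.trans (R.+-congˡ {a · r} 0∷[]) (R.+-identityʳ _))

  -- A nonzero polynomial is an associate of a monic one. Both scalars are kept: in Euclid's
  -- algorithm divisors pass from `t'` to `t` by `a`, and Bezout coefficients from `t` to `t'` by
  -- `b`.
  normalise : ∀ m t → Bounded m t →
    t ≋ [] ⊎ ∃₂ λ a b → ∃₂ λ k t' → k < m × IsMonic k t' × t ≋ ([ a ] *P t') × t' ≋ ([ b ] *P t)
  normalise zero    t bt = inj₁ (bounded-zero bt)
  normalise (suc m) t bt with coeff t m ≈? 0#
  ... | yes z with normalise m t (bounded-pred z bt)
  ...   | inj₁ t≋0 = inj₁ t≋0
  ...   | inj₂ (a , b , k , t' , k<m , rest) = inj₂ (a , b , k , t' , ℕ.m<n⇒m<1+n k<m , rest)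
  normalise (suc m) t bt | no nz with inverse (coeff t m) nz
  ... | y , xy≈1 = inj₂ (coeff t m , y , m , y · t , ℕ.n<1+n m
        , mk (trans (coeff-· y t m) (trans (*-comm y _) xy≈1)) (bounded-· y bt)
        , R.sym (R.trans (R.sym (·≋* (coeff t m) (y · t)))
            (R.trans (R.sym (·-assoc (coeff t m) y t)) (R.trans (·-cong xy≈1 ≋-refl) (1·-identity t))))
        , ·≋* y t)

-- Divisibility, greatest common divisors and irreducibles.

module Divisibility {q : ℕ} {c ℓ : Level} (F : FiniteField q c ℓ) where
  open FiniteField F using (1#)
  open Poly F
  open PolyRing F
  open Degree F
  private
    module R = CommutativeRing polyRing
  open SemiringDivisibility R.semiring public
    using (_,_; ∣ˡ-refl; ∣ˡ-trans; ∣ˡ-reflexive; x∣ˡy⇒x∣ˡyz; x∣ˡy⇒zx∣ˡzy; x∣ˡxy; ∣ˡ-respʳ-≈; ∣ˡ-respˡ-≈)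
    renaming (_∣ˡ_ to _∣_)
  open SetoidReasoning R.setoid
  open SemiringSolver R.commutativeSemiring using (solve; _:=_; _:+_; _:*_)
  open RingProperties R.ring using (-‿distribʳ-*)

  ∣⇒∣P : ∀ {g p} → g ∣ p → g ∣P p
  ∣⇒∣P (h , e) = h , at e

  ∣P⇒∣ : ∀ {g p} → g ∣P p → g ∣ p
  ∣P⇒∣ (h , e) = h , mk e

  ∣-+ : ∀ {g p r} → g ∣ p → g ∣ r → g ∣ (p +P r)
  ∣-+ {g} (h , e) (h' , e') = h +P h' , R.trans (R.distribˡ g h h') (R.+-cong e e')

  ∣-neg : ∀ {g p} → g ∣ p → g ∣ (-P p)
  ∣-neg {g} {p} (h , e) = (-P h) , R.trans (R.sym (-‿distribʳ-* g h)) (R.-‿cong e)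

  ∣-- : ∀ {g p r} → g ∣ p → g ∣ r → g ∣ (p +P (-P r))
  ∣-- d d' = ∣-+ d (∣-neg d')

  ∣-*ˡ : ∀ {g p} r → g ∣ p → g ∣ (r *P p)
  ∣-*ˡ {g} {p} r d = ∣ˡ-respʳ-≈ (R.*-comm p r) (x∣ˡy⇒x∣ˡyz r d)

  ∣-+-cancelˡ : ∀ {g p r} → g ∣ p → g ∣ (p +P r) → g ∣ r
  ∣-+-cancelˡ {g} {p} {r} d d' =
    ∣ˡ-respʳ-≈ (begin
      ((p +P r) +P (-P p)) ≈⟨ R.+-congʳ (R.+-comm p r) ⟩
      ((r +P p) +P (-P p)) ≈⟨ R.+-assoc r p (-P p) ⟩
      (r +P (p +P (-P p))) ≈⟨ R.+-congˡ (R.-‿inverseʳ p) ⟩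
      (r +P [])            ≈⟨ R.+-identityʳ r ⟩
      r                    ∎) (∣-- d' d)

  bounded-∣⇒0 : ∀ {m g p} → IsMonic m g → Bounded m p → g ∣ p → p ≋ []
  bounded-∣⇒0 {m} {g} {p} mg bp (h , e) = begin
    p         ≈⟨ e ⟨
    (g *P h)  ≈⟨ *P-congˡ g (bounded-zero (quotient-bounded mg
                   (≡.subst (λ k → Bounded k (g *P h)) (≡.sym (ℕ.+-identityʳ m)) (bounded-resp (R.sym e) bp)))) ⟩
    (g *P []) ≈⟨ *P-zeroʳ g ⟩
    []        ∎

  zero? : ∀ p → Dec (p ≋ [])
  zero? p with normalise _ p (bounded-length p)
  ... | inj₁ z = yes z
  ... | inj₂ (a , b , k , t , _ , mt , _ , e) = no λ z →
        monic≉0 mt (R.trans e (R.trans (*P-congˡ [ b ] z) (*P-zeroʳ [ b ])))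

  opaque
    ∣? : ∀ {m g} → IsMonic m g → ∀ p → Dec (g ∣ p)
    ∣? {m} {g} mg p with divMod mg p
    ... | s , t , e , bt with zero? t
    ...   | yes t≋0 = yes (s , R.sym (R.trans e (R.trans (R.+-congˡ t≋0) (R.+-identityʳ _))))
    ...   | no t≉0  = no λ d → t≉0 (bounded-∣⇒0 mg bt (∣-+-cancelˡ (x∣ˡxy g s) (∣ˡ-respʳ-≈ e d)))

  monic-∣-degree : ∀ {m n g f} → IsMonic m g → IsMonic n f → g ∣ f → m ≤ n
  monic-∣-degree mg mf (h , e) = monic-divisor-degree mg (monic-resp (R.sym e) mf)

  monic-∣-≋ : ∀ {m g f} → IsMonic m g → IsMonic m f → g ∣ f → g ≋ f
  monic-∣-≋ {m} {g} {f} mg mf (h , e) = begin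
    g             ≈⟨ R.*-identityʳ g ⟨
    (g *P [ 1# ]) ≈⟨ *P-congˡ g (monic-0⇒1 (≡.subst (λ k → IsMonic k h) (ℕ.n∸n≡0 m)
                       (monic-quotient mg (monic-resp (R.sym e) mf)))) ⟨
    (g *P h)      ≈⟨ e ⟩
    f             ∎

  -- That `d` is greatest is encoded by the Bezout identity: every common divisor divides the
  -- combination.
  MonicGcd : Poly → Poly → Set (c ⊔ ℓ)
  MonicGcd f g = ∃₂ λ k d → IsMonic k d × d ∣ f × d ∣ g × ∃₂ λ s t → ((f *P s) +P (g *P t)) ≋ d

  opaque
    -- Euclid's algorithm, by induction on the degree of the monic second argument; each remainder
    -- is made monic before it takes that place.
    monic-gcd : ∀ n f g → IsMonic n g → MonicGcd f g
    monic-gcd = <-rec _ go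
      where
      go : ∀ n → (∀ {m} → m < n → ∀ f g → IsMonic m g → MonicGcd f g) → ∀ f g → IsMonic n g → MonicGcd f g
      go n rec f g mg with divMod mg f
      ... | s , t , e , bt with normalise n t bt
      ...   | inj₁ t≋0 = n , g , mg , (s , R.sym (R.trans e (R.trans (R.+-congˡ t≋0) (R.+-identityʳ _))))
              , ∣ˡ-refl , [] , [ 1# ] , R.trans (R.+-congʳ (*P-zeroʳ f)) (R.*-identityʳ g)
      ...   | inj₂ (a , b , k , t' , k<n , mt' , t≋at' , t'≋bt) with rec k<n g t' mt'
      ...     | j , d , md , d∣g , d∣t' , u , v , eq = j , d , md
                , ∣ˡ-respʳ-≈ (R.sym e) (∣-+ (x∣ˡy⇒x∣ˡyz s d∣g) (∣ˡ-respʳ-≈ (R.sym t≋at') (∣-*ˡ [ a ] d∣t')))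
                -- The recursion gives d = g u + t' v; substituting t' = b (f - g s) yields the
                -- coefficients of `f` and `g`.
                , d∣g , ([ b ] *P v) , (u +P (s' *P ([ b ] *P v))) , (begin
        ((f *P ([ b ] *P v)) +P (g *P (u +P (s' *P ([ b ] *P v)))))
          ≈⟨ solve 6 (λ f g s b u v → ((f :* (b :* v)) :+ (g :* (u :+ (s :* (b :* v)))))
                                   := ((g :* u) :+ ((b :* (f :+ (g :* s))) :* v))) R.refl f g s' [ b ] u v ⟩
        ((g *P u) +P (([ b ] *P (f +P (g *P s'))) *P v))
          ≈⟨ R.+-congˡ {g *P u} (*P-congʳ ([ b ] *P (f +P (g *P s'))) t' (R.trans (*P-congˡ [ b ] remainder) (R.sym t'≋bt))) ⟩
        ((g *P u) +P (t' *P v)) ≈⟨ eq ⟩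
        d ∎)
        where
        s' : Poly
        s' = -P s
        remainder : (f +P (g *P s')) ≋ t
        remainder = begin
          (f +P (g *P s'))                    ≈⟨ R.+-congʳ e ⟩
          (((g *P s) +P t) +P (g *P s'))      ≈⟨ R.+-congʳ (R.+-comm (g *P s) t) ⟩
          ((t +P (g *P s)) +P (g *P s'))      ≈⟨ R.+-assoc t (g *P s) (g *P s') ⟩
          (t +P ((g *P s) +P (g *P s')))      ≈⟨ R.+-congˡ {t} (R.+-congˡ {g *P s} (-‿distribʳ-* g s)) ⟨
          (t +P ((g *P s) +P (-P (g *P s))))  ≈⟨ R.+-congˡ (R.-‿inverseʳ (g *P s)) ⟩
          (t +P [])                           ≈⟨ R.+-identityʳ t ⟩
          t                                   ∎

  record Coprime (f g : Poly) : Set (c ⊔ ℓ) where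
    constructor mk
    field
      s t   : Poly
      bezout : ((f *P s) +P (g *P t)) ≋ [ 1# ]

  -- The Bezout identity times `h` writes `h` as a combination of `f` and `g *P h`.
  coprime-∣ : ∀ {f g h} → Coprime f g → f ∣ (g *P h) → f ∣ h
  coprime-∣ {f} {g} {h} (mk s t e) d = ∣ˡ-respʳ-≈ (begin
    ((f *P (s *P h)) +P (t *P (g *P h)))
      ≈⟨ solve 5 (λ f g h s t → ((f :* (s :* h)) :+ (t :* (g :* h))) := (((f :* s) :+ (g :* t)) :* h)) R.refl f g h s t ⟩
    (((f *P s) +P (g *P t)) *P h) ≈⟨ *P-congʳ ((f *P s) +P (g *P t)) [ 1# ] e ⟩
    ([ 1# ] *P h)                 ≈⟨ R.*-identityˡ h ⟩
    h                             ∎) (∣-+ (x∣ˡy⇒x∣ˡyz (s *P h) ∣ˡ-refl) (∣-*ˡ t d))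

  coprime-* : ∀ {f g h} → Coprime f g → f ∣ h → g ∣ h → (f *P g) ∣ h
  coprime-* {f} {g} {h} cop f∣h (k , e) with coprime-∣ {f} {g} {k} cop (∣ˡ-respʳ-≈ (R.sym e) f∣h)
  ... | j , e' = j , (begin
    ((f *P g) *P j) ≈⟨ R.trans (*P-congʳ (f *P g) (g *P f) (R.*-comm f g)) (R.*-assoc g f j) ⟩
    (g *P (f *P j)) ≈⟨ *P-congˡ g e' ⟩
    (g *P k)        ≈⟨ e ⟩
    h               ∎)

  -- Irreducibility is tested on degrees of monic divisors only: degree 0 forces the divisor 1, and
  -- degree `m` forces `P` itself.
  record IsPrime (m : ℕ) (P : Poly) : Set (c ⊔ ℓ) where
    constructor mk
    field
      monic       : IsMonic m P
      positive    : 1 ≤ m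
      irreducible : ∀ {k g} → IsMonic k g → g ∣ P → k ≡ 0 ⊎ k ≡ m
  open IsPrime public

  prime-coprime : ∀ {m P a} → IsPrime m P → ¬ P ∣ a → Coprime P a
  prime-coprime {m} {P} {a} pP P∤a with monic-gcd m a P (monic pP)
  ... | k , d , md , d∣a , d∣P , s , t , e with irreducible pP md d∣P
  ...   | inj₁ ≡.refl = mk t s (R.trans (R.+-comm (P *P t) (a *P s)) (R.trans e (monic-0⇒1 md)))
  ...   | inj₂ ≡.refl = contradiction (∣ˡ-respˡ-≈ (monic-∣-≋ md (monic pP) d∣P) d∣a) P∤a

  euclid : ∀ {m P} a b → IsPrime m P → P ∣ (a *P b) → ¬ P ∣ a → P ∣ b
  euclid a b pP d P∤a = coprime-∣ (prime-coprime pP P∤a) d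

-- Counting with duplicate-free lists.

module _ {a} {A : Set a} where

  unique-⊆-length : {xs ys : List A} → Unique xs → (∀ {x} → x ∈ xs → x ∈ ys) → length xs ≤ length ys
  unique-⊆-length {[]}     _        _   = z≤n
  unique-⊆-length {x ∷ xs} (x∉ ∷ u) sub with ∈-∃++ (sub (here ≡.refl))
  ... | as , bs , ≡.refl = ℕ.≤-trans (s≤s (unique-⊆-length u sub′)) (ℕ.≤-reflexive (≡.sym (begin
      length (as ++ x ∷ bs)            ≡⟨ List.length-++ as ⟩
      length as ℕ.+ suc (length bs)    ≡⟨ ℕ.+-suc _ _ ⟩
      suc (length as ℕ.+ length bs)    ≡⟨ ≡.cong suc (List.length-++ as) ⟨
      suc (length (as ++ bs))          ∎)))
    where
    open ≡.≡-Reasoning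
    sub′ : ∀ {y} → y ∈ xs → y ∈ as ++ bs
    sub′ y∈ with ∈-++⁻ as (sub (there y∈))
    ... | inj₁ y∈as            = ∈-++⁺ˡ y∈as
    ... | inj₂ (here ≡.refl)   = contradiction ≡.refl (All.lookup x∉ y∈)
    ... | inj₂ (there y∈bs)    = ∈-++⁺ʳ as y∈bs

  -- A missing `y` could be put in front of `xs`, giving a duplicate-free sublist longer than `ys`.
  unique-⊆-full : DecidableEquality A → {xs ys : List A} → Unique xs → (∀ {x} → x ∈ xs → x ∈ ys) →
                  length ys ≤ length xs → ∀ {y} → y ∈ ys → y ∈ xs
  unique-⊆-full _≟_ {xs} {ys} u sub len {y} y∈ys with Any.any? (y ≟_) xs
  ... | yes y∈xs = y∈xs
  ... | no  y∉xs = contradiction len (ℕ.<⇒≱ (unique-⊆-length {y ∷ xs} {ys}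
          (All.tabulate (λ x∈ y≡x → y∉xs (≡.subst (_∈ xs) (≡.sym y≡x) x∈)) ∷ u)
          λ { (here ≡.refl) → y∈ys ; (there x∈) → sub x∈ }))

-- Monic polynomials as vectors over a finite type.

module Codes {q : ℕ} {c ℓ : Level} (F : FiniteField q c ℓ) where
  open FiniteField F using (enum; enum-inj)
  open Poly F
  open PolyRing F
  open Degree F
  open Divisibility F
  private
    module R = CommutativeRing polyRing

  -- Canonical representatives of monic polynomials, on which _≋_ is _≡_.
  Code : ℕ → Set
  Code n = Vec (Fin q) n

  poly : ∀ {n} → Code n → Poly
  poly w = ⟦ V.map enum w ⟧

  poly-monic : ∀ {n} (w : Code n) → IsMonic n (poly w)
  poly-monic w = ⟦⟧-monic (V.map enum w)

  encode : ∀ {n} → Monic n → Code n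
  encode = V.map idx

  poly-encode : ∀ {n} (v : Monic n) → poly (encode v) ≋ ⟦ v ⟧
  poly-encode []      = ≋-refl
  poly-encode (a ∷ v) = ∷-cong (enum-idx a) (poly-encode v)

  opaque
    code : ∀ {n p} → IsMonic n p → ∃ λ (w : Code n) → poly w ≋ p
    code mp with toMonic _ _ mp
    ... | v , e = encode v , R.trans (poly-encode v) e

  poly-injective : ∀ {n} {w w' : Code n} → poly w ≋ poly w' → w ≡ w'
  poly-injective {w = []}    {[]}     e = ≡.refl
  poly-injective {w = a ∷ w} {b ∷ w'} e =
    ≡.cong₂ _∷_ (enum-inj _ _ (at e 0)) (poly-injective (tail-≋ e))

  _≟C_ : ∀ {n} → DecidableEquality (Code n)
  _≟C_ = Vec.≡-dec Fin._≟_

  opaque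
    codes : ∀ n → List (Code n)
    codes zero    = [ [] ]
    codes (suc n) = cartesianProductWith _∷_ (allFin q) (codes n)

    ∈-codes : ∀ {n} (w : Code n) → w ∈ codes n
    ∈-codes []      = here ≡.refl
    ∈-codes (a ∷ w) = ∈-cartesianProductWith⁺ _∷_ (∈-allFin a) (∈-codes w)

    codes-unique : ∀ n → Unique (codes n)
    codes-unique zero    = [] ∷ []
    codes-unique (suc n) = Unique.cartesianProductWith⁺ _∷_ Vec.∷-injective (Unique.allFin⁺ q) (codes-unique n)

    length-codes : ∀ n → length (codes n) ≡ q ^ n
    length-codes zero    = ≡.refl
    length-codes (suc n) = ≡.trans (length-product (allFin q)) (≡.cong₂ ℕ._*_ {u = length (codes n)} (List.length-tabulate {n = q} (λ i → i)) (length-codes n))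
      where
      length-product : (xs : List (Fin q)) → length (cartesianProductWith V._∷_ xs (codes n)) ≡ length xs ℕ.* length (codes n)
      length-product []       = ≡.refl
      length-product (x ∷ xs) = ≡.trans (List.length-++ (map (x V.∷_) (codes n)))
        (≡.cong₂ ℕ._+_ (List.length-map _ (codes n)) (length-product xs))

  ∃code? : ∀ {n p} {P : Code n → Set p} → Decidable P → Dec (∃ P)
  ∃code? {n} P? = map′ (λ a → let w , _ , pw = find a in w , pw)
                       (λ { (w , pw) → lose (∈-codes w) pw }) (Any.any? P? (codes n))

  ProperDivisor : ∀ {n} → Code n → ℕ → Set (c ⊔ ℓ)
  ProperDivisor w k = 1 ≤ k × ∃ λ (v : Code k) → poly v ∣ poly w

  opaque
    -- A finite search: there are finitely many codes of each smaller degree, and divisibility by a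
    -- monic polynomial is decided by its remainder.
    split : ∀ {n} (w : Code n) → 1 ≤ n →
            IsPrime n (poly w) ⊎ ∃ λ k → k < n × ProperDivisor w k
    split {n} w 1≤n with ℕ.anyUpTo? (λ k → (1 ℕ.≤? k) ×-dec ∃code? (λ v → ∣? (poly-monic v) (poly w))) n
    ... | yes (k , k<n , d) = inj₂ (k , k<n , d)
    ... | no none = inj₁ (mk (poly-monic w) 1≤n irr)
      where
      irr : ∀ {k g} → IsMonic k g → g ∣ poly w → k ≡ 0 ⊎ k ≡ n
      irr {zero}  mg g∣w = inj₁ ≡.refl
      irr {suc k} mg g∣w with ℕ.m≤n⇒m<n∨m≡n (monic-∣-degree mg (poly-monic w) g∣w)
      ... | inj₂ eq  = inj₂ eq
      ... | inj₁ k<n with code mg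
      ...   | v , e = contradiction (suc k , k<n , s≤s z≤n , v , ∣ˡ-respˡ-≈ (R.sym e) g∣w) none

  opaque
    prime? : ∀ {n} (w : Code n) → Dec (IsPrime n (poly w))
    prime? {zero}  w = no λ pw → contradiction (positive pw) λ ()
    prime? {suc n} w with split w (s≤s z≤n)
    ... | inj₁ pw = yes pw
    ... | inj₂ (k , k<n , 1≤k , v , v∣w) = no λ pw → absurd (irreducible pw (poly-monic v) v∣w)
      where
      absurd : ¬ (k ≡ 0 ⊎ k ≡ suc n)
      absurd (inj₁ ≡.refl) = contradiction 1≤k λ ()
      absurd (inj₂ ≡.refl) = ℕ.<-irrefl ≡.refl k<n

  HasPrimeFactor : ∀ {n} → Code n → Set (c ⊔ ℓ)
  HasPrimeFactor w = ∃₂ λ r (v : Code r) → IsPrime r (poly v) × poly v ∣ poly w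

  opaque
    prime-factor : ∀ n (w : Code n) → 1 ≤ n → HasPrimeFactor w
    prime-factor = <-rec _ go
      where
      go : ∀ n → (∀ {k} → k < n → (v : Code k) → 1 ≤ k → HasPrimeFactor v) → (w : Code n) → 1 ≤ n → HasPrimeFactor w
      go n rec w 1≤n with split w 1≤n
      ... | inj₁ pw = n , w , pw , ∣ˡ-refl
      ... | inj₂ (k , k<n , 1≤k , v , v∣w) with rec k<n v 1≤k
      ...   | r , u , pu , u∣v = r , u , pu , ∣ˡ-trans u∣v v∣w

  opaque
    -- The degree is passed through an equation, so that a product which should have degree `m` is
    -- indexed by `m` and not by a sum.
    multiple : ∀ {j k m g} → IsMonic j g → j ℕ.+ k ≡ m → Code k → Code m
    multiple mg ≡.refl w = proj₁ (code (monic-* mg (poly-monic w)))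

    poly-multiple : ∀ {j k m g} (mg : IsMonic j g) (eq : j ℕ.+ k ≡ m) (w : Code k) →
                    poly (multiple mg eq w) ≋ (g *P poly w)
    poly-multiple mg ≡.refl w = proj₂ (code (monic-* mg (poly-monic w)))

  multiple-injective : ∀ {j k m g} (mg : IsMonic j g) (eq : j ℕ.+ k ≡ m) {w w' : Code k} →
                       multiple mg eq w ≡ multiple mg eq w' → w ≡ w'
  multiple-injective {g = g} mg eq {w} {w'} e = poly-injective (monic-cancel mg (R.trans (R.sym (poly-multiple mg eq w))
    (R.trans (R.reflexive (≡.cong poly e)) (poly-multiple mg eq w'))))

  opaque
    cofactor : ∀ {j k m g} (mg : IsMonic j g) (eq : j ℕ.+ k ≡ m) (w : Code m) → g ∣ poly w →
               ∃ λ (v : Code k) → multiple mg eq v ≡ w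
    cofactor {g = g} mg ≡.refl w (h , e) with code (quotient-monic mg (monic-resp (R.sym e) (poly-monic w)))
    ... | v , v≋h = v , poly-injective (R.trans (poly-multiple mg ≡.refl v) (R.trans (*P-congˡ g v≋h) e))

  ∣-multiple : ∀ {j k m g} (mg : IsMonic j g) (eq : j ℕ.+ k ≡ m) (w : Code k) → g ∣ poly (multiple mg eq w)
  ∣-multiple mg eq w = poly w , R.sym (poly-multiple mg eq w)

-- Indicators and finite sums.

private
  module ℕ+ = CommutativeSemigroupProperties ℕ.+-commutativeSemigroup
  module ℕ* = CommutativeSemigroupProperties ℕ.*-commutativeSemigroup

ind : ∀ {p} {P : Set p} → Dec P → ℕ
ind (yes _) = 1
ind (no _)  = 0

ind-cong : ∀ {p r} {P : Set p} {R : Set r} → (P → R) → (R → P) → (P? : Dec P) (R? : Dec R) → ind P? ≡ ind R?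
ind-cong to from (yes p) (yes r) = ≡.refl
ind-cong to from (yes p) (no ¬r) = contradiction (to p) ¬r
ind-cong to from (no ¬p) (yes r) = contradiction (from r) ¬p
ind-cong to from (no ¬p) (no ¬r) = ≡.refl

ind-yes : ∀ {p} {P : Set p} → P → (P? : Dec P) → ind P? ≡ 1
ind-yes p (yes _) = ≡.refl
ind-yes p (no ¬p) = contradiction p ¬p

ind-no : ∀ {p} {P : Set p} → ¬ P → (P? : Dec P) → ind P? ≡ 0
ind-no ¬p (yes p) = contradiction p ¬p
ind-no ¬p (no _)  = ≡.refl

module _ {a} {A : Set a} where

  ∑ : List A → (A → ℕ) → ℕ
  ∑ []       f = 0
  ∑ (x ∷ xs) f = f x ℕ.+ ∑ xs f

  ∑-cong : ∀ xs {f g : A → ℕ} → (∀ {x} → x ∈ xs → f x ≡ g x) → ∑ xs f ≡ ∑ xs g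
  ∑-cong []       e = ≡.refl
  ∑-cong (x ∷ xs) e = ≡.cong₂ ℕ._+_ (e (here ≡.refl)) (∑-cong xs (e ∘ there))

  ∑-mono : ∀ xs {f g : A → ℕ} → (∀ {x} → x ∈ xs → f x ≤ g x) → ∑ xs f ≤ ∑ xs g
  ∑-mono []       e = z≤n
  ∑-mono (x ∷ xs) e = ℕ.+-mono-≤ (e (here ≡.refl)) (∑-mono xs (e ∘ there))

  ∑-zero : ∀ xs → ∑ xs (λ _ → 0) ≡ 0
  ∑-zero []       = ≡.refl
  ∑-zero (x ∷ xs) = ∑-zero xs

  ∑-+ : ∀ xs (f g : A → ℕ) → ∑ xs (λ x → f x ℕ.+ g x) ≡ ∑ xs f ℕ.+ ∑ xs g
  ∑-+ []       f g = ≡.refl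
  ∑-+ (x ∷ xs) f g = ≡.trans (≡.cong (f x ℕ.+ g x ℕ.+_) (∑-+ xs f g)) (ℕ+.interchange (f x) (g x) _ _)

  ∑-* : ∀ xs k (f : A → ℕ) → ∑ xs (λ x → k ℕ.* f x) ≡ k ℕ.* ∑ xs f
  ∑-* []       k f = ≡.sym (ℕ.*-zeroʳ k)
  ∑-* (x ∷ xs) k f = ≡.trans (≡.cong (k ℕ.* f x ℕ.+_) (∑-* xs k f)) (≡.sym (ℕ.*-distribˡ-+ k (f x) _))

  ∑-const : ∀ xs k → ∑ xs (λ _ → k) ≡ length xs ℕ.* k
  ∑-const []       k = ≡.refl
  ∑-const (x ∷ xs) k = ≡.cong (k ℕ.+_) (∑-const xs k)

  ∑-ind : ∀ {p} {P : A → Set p} (P? : Decidable P) xs → ∑ xs (λ x → ind (P? x)) ≡ length (filter P? xs)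
  ∑-ind P? []       = ≡.refl
  ∑-ind P? (x ∷ xs) with P? x
  ... | yes _ = ≡.cong suc (∑-ind P? xs)
  ... | no _  = ∑-ind P? xs

  -- Isolates the single index at which two summands differ; `Unique` guarantees that `y` is met
  -- only once. It will compare the multiplicities in a polynomial with those after one prime factor
  -- is removed.
  ∑-bump : ∀ {xs y} {f g : A → ℕ} k → Unique xs → y ∈ xs → f y ≡ k ℕ.+ g y →
           (∀ {x} → x ∈ xs → x ≢ y → f x ≡ g x) → ∑ xs f ≡ k ℕ.+ ∑ xs g
  ∑-bump {x ∷ xs} {f = f} {g} k (x∉ ∷ u) (here ≡.refl) e e' = ≡.trans
    (≡.cong₂ ℕ._+_ e (∑-cong xs λ z∈ → e' (there z∈) λ { ≡.refl → All.lookup x∉ z∈ ≡.refl }))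
    (ℕ.+-assoc k (g x) _)
  ∑-bump {x ∷ xs} {y} {f} {g} k (x∉ ∷ u) (there y∈) e e' = ≡.trans
    (≡.cong₂ ℕ._+_ (e' (here ≡.refl) (All.lookup x∉ y∈)) (∑-bump k u y∈ e (e' ∘ there)))
    (ℕ+.x∙yz≈y∙xz (g x) k (∑ xs g))

∑-swap : ∀ {a b} {A : Set a} {B : Set b} xs ys (f : A → B → ℕ) →
         ∑ xs (λ x → ∑ ys (f x)) ≡ ∑ ys (λ y → ∑ xs (λ x → f x y))
∑-swap []       ys f = ≡.sym (∑-zero ys)
∑-swap (x ∷ xs) ys f = ≡.trans (≡.cong (∑ ys (f x) ℕ.+_) (∑-swap xs ys f)) (≡.sym (∑-+ ys (f x) _))

-- Irreducible polynomials of every positive degree.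

module PrimeExistence {q : ℕ} {c ℓ : Level} (F : FiniteField q c ℓ) where
  open FiniteField F using (0#; 1#; 1≉0; sym)
  open Poly F
  open PolyRing F
  open Degree F
  open Divisibility F
  open Codes F
  private
    module R = CommutativeRing polyRing

  -- The number of monic multiples of degree m of a monic polynomial of degree j.
  multiples : ℕ → ℕ → ℕ
  multiples m       zero    = q ^ m
  multiples zero    (suc j) = 0
  multiples (suc m) (suc j) = multiples m j

  multiples-≤ : ∀ j {k m} → j ℕ.+ k ≡ m → multiples m j ≡ q ^ k
  multiples-≤ zero    ≡.refl = ≡.refl
  multiples-≤ (suc j) ≡.refl = multiples-≤ j ≡.refl

  multiples-> : ∀ {m j} → m < j → multiples m j ≡ 0
  multiples-> {zero}  {suc j} _         = ≡.refl
  multiples-> {suc m} {suc j} (s≤s m<j) = multiples-> m<j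

  -- Multiplication by `g` is injective and its image is the set of multiples, so the cofactors of
  -- degree m - j are counted instead.
  count-multiples : ∀ {j g} m (mg : IsMonic j g) → ∑ (codes m) (λ w → ind (∣? mg (poly w))) ≡ multiples m j
  count-multiples {j} m mg with j ℕ.≤? m
  ... | no j≰m = ≡.trans (∑-cong (codes m) λ {w} _ →
                   ind-no (λ d → j≰m (monic-∣-degree mg (poly-monic w) d)) (∣? mg (poly w)))
                 (≡.trans (∑-zero (codes m)) (≡.sym (multiples-> (ℕ.≰⇒> j≰m))))
  ... | yes j≤m = begin
      ∑ (codes m) (λ w → ind (D? w))                ≡⟨ ∑-ind D? (codes m) ⟩
      length (filter D? (codes m))                  ≡⟨ ℕ.≤-antisym le ge ⟩
      length (map (multiple mg eq) (codes k))       ≡⟨ List.length-map (multiple mg eq) (codes k) ⟩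
      length (codes k)                              ≡⟨ length-codes k ⟩
      q ^ k                                         ≡⟨ multiples-≤ j eq ⟨
      multiples m j                                 ∎
    where
    open ≡.≡-Reasoning
    D? = λ (w : Code m) → ∣? mg (poly w)
    k = m ℕ.∸ j
    eq : j ℕ.+ k ≡ m
    eq = ℕ.m+[n∸m]≡n j≤m
    le : length (filter D? (codes m)) ≤ length (map (multiple mg eq) (codes k))
    le = unique-⊆-length (Unique.filter⁺ D? (codes-unique m)) λ {w} w∈ →
      let v , e = cofactor mg eq w (proj₂ (∈-filter⁻ D? {xs = codes m} w∈))
      in ≡.subst (_∈ _) e (∈-map⁺ (multiple mg eq) (∈-codes v))
    ge : length (map (multiple mg eq) (codes k)) ≤ length (filter D? (codes m))
    ge = unique-⊆-length (Unique.map⁺ (multiple-injective mg eq) (codes-unique k)) λ w∈ →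
      case (∈-map⁻ (multiple mg eq) w∈)
      where
      case : ∀ {w} → (∃ λ v → v ∈ codes k × w ≡ multiple mg eq v) → w ∈ filter D? (codes m)
      case (v , _ , ≡.refl) = ∈-filter⁺ D? (∈-codes _) (∣-multiple mg eq v)

  pow : Poly → ℕ → Poly
  pow P zero    = [ 1# ]
  pow P (suc i) = P *P pow P i

  pow-monic : ∀ {r P} → IsMonic r P → ∀ i → IsMonic (i ℕ.* r) (pow P i)
  pow-monic mP zero    = monic-1
  pow-monic mP (suc i) = monic-* mP (pow-monic mP i)

  -- The multiplicity of P in f, for N at least that multiplicity.
  mult : ∀ {r} → ℕ → Code r → Poly → ℕ
  mult zero    P f = 0
  mult (suc N) P f = mult N P f ℕ.+ ind (∣? (pow-monic (poly-monic P) (suc N)) f)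

  mult-cong : ∀ {r} N (P : Code r) f g → (∀ i → pow (poly P) i ∣ f → pow (poly P) i ∣ g) →
              (∀ i → pow (poly P) i ∣ g → pow (poly P) i ∣ f) → mult N P f ≡ mult N P g
  mult-cong zero    P f g to from = ≡.refl
  mult-cong (suc N) P f g to from = ≡.cong₂ ℕ._+_ (mult-cong N P f g to from) (ind-cong (to (suc N)) (from (suc N)) _ _)

  coprime-sym : ∀ {f g} → Coprime f g → Coprime g f
  coprime-sym {f} {g} (mk s t e) = mk t s (R.trans (R.+-comm (g *P t) (f *P s)) e)

  prime-∤-1 : ∀ {r Q} → IsPrime r Q → ¬ Q ∣ [ 1# ]
  prime-∤-1 pQ d = contradiction (ℕ.≤-trans (positive pQ) (monic-∣-degree (monic pQ) monic-1 d)) λ ()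

  prime-∤-pow : ∀ {r Q P} → IsPrime r Q → ¬ Q ∣ P → ∀ i → ¬ Q ∣ pow P i
  prime-∤-pow pQ Q∤P zero    d = prime-∤-1 pQ d
  prime-∤-pow {P = P} pQ Q∤P (suc i) d = prime-∤-pow pQ Q∤P i (euclid P (pow P i) pQ d Q∤P)

  -- Every power of `P` is coprime to `Q`, so it divides Q g only if it divides g. The two primes
  -- may have different degrees, hence the inequality of pairs.
  mult-other : ∀ {r s} N {P : Code r} {Q : Code s} g → IsPrime r (poly P) → IsPrime s (poly Q) →
               (r , P) ≢ (s , Q) → mult N P (poly Q *P g) ≡ mult N P g
  mult-other {r} {s} N {P} {Q} g pP pQ P≢Q = mult-cong N P _ g
    (λ i → coprime-∣ (coprime-sym (prime-coprime pQ (prime-∤-pow pQ Q∤P i))))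
    (λ i → ∣-*ˡ (poly Q))
    where
    Q∤P : ¬ poly Q ∣ poly P
    Q∤P d with irreducible pP (monic pQ) d
    ... | inj₁ ≡.refl = contradiction (positive pQ) λ ()
    ... | inj₂ ≡.refl = P≢Q (≡.cong (s ,_) (≡.sym (poly-injective (monic-∣-≋ (monic pQ) (monic pP) d))))

  ∣-cancel : ∀ {m} Q f g → IsMonic m Q → (Q *P f) ∣ (Q *P g) → f ∣ g
  ∣-cancel Q f g mQ (h , e) = h , monic-cancel mQ (R.trans (R.sym (R.*-assoc Q f h)) e)

  -- Q^(i+1) divides Q g exactly when Q^i divides g: the terms shift by one, and the extra term, for
  -- exponent 1, always counts.
  mult-same : ∀ {r} N {Q : Code r} g → mult (suc N) Q (poly Q *P g) ≡ suc (mult N Q g)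
  mult-same zero    {Q} g = ind-yes (∣ˡ-respˡ-≈ (R.sym (R.*-identityʳ (poly Q))) (x∣ˡxy (poly Q) g))
    (∣? (pow-monic (poly-monic Q) 1) (poly Q *P g))
  mult-same (suc N) {Q} g = ≡.cong₂ ℕ._+_ (mult-same N {Q} g) (ind-cong
    (∣-cancel (poly Q) (pow (poly Q) (suc N)) g (poly-monic Q))
    (x∣ˡy⇒zx∣ˡzy (poly Q))
    (∣? (pow-monic (poly-monic Q) (suc (suc N))) (poly Q *P g))
    (∣? (pow-monic (poly-monic Q) (suc N)) g))

  pow-∤ : ∀ {r n P f} → IsPrime r P → IsMonic n f → ∀ {i} → n < i → ¬ pow P i ∣ f
  pow-∤ {r} pP mf {i} n<i d = ℕ.<⇒≱ n<i (ℕ.≤-trans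
    (≡.subst (_≤ i ℕ.* r) (ℕ.*-identityʳ i) (ℕ.*-monoʳ-≤ i (positive pP)))
    (monic-∣-degree (pow-monic (monic pP) i) mf d))

  -- A power of exponent above `n` has degree above `n`, since primes have positive degree. This
  -- restores the cut-off that `mult-same` lowers by one.
  mult-top : ∀ {r n N f} {P : Code r} → IsPrime r (poly P) → IsMonic n f → n ≤ N → mult (suc N) P f ≡ mult N P f
  mult-top {N = N} {f} {P} pP mf n≤N = ≡.trans
    (≡.cong (mult N P f ℕ.+_)
      (ind-no (pow-∤ pP mf {suc N} (s≤s n≤N)) (∣? (pow-monic (poly-monic P) (suc N)) f)))
    (ℕ.+-identityʳ _)

  mult-constant : ∀ {r N f} {P : Code r} → IsPrime r (poly P) → IsMonic 0 f → mult N P f ≡ 0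
  mult-constant {N = zero}  pP mf = ≡.refl
  mult-constant {N = suc N} pP mf = ≡.trans (mult-top {N = N} pP mf z≤n) (mult-constant {N = N} pP mf)

  primes : ℕ → List (∃ Code)
  primes zero    = []
  primes (suc N) = primes N ++ map (suc N ,_) (filter prime? (codes (suc N)))

  ∈-primes⁻ : ∀ N {r P} → (r , P) ∈ primes N → IsPrime r (poly P) × r ≤ N
  ∈-primes⁻ (suc N) P∈ with ∈-++⁻ (primes N) P∈
  ... | inj₁ P∈′ = let pP , r≤N = ∈-primes⁻ N P∈′ in pP , ℕ.m≤n⇒m≤1+n r≤N
  ... | inj₂ P∈′ with ∈-map⁻ (suc N ,_) P∈′
  ...   | P , P∈″ , ≡.refl = proj₂ (∈-filter⁻ prime? {xs = codes (suc N)} P∈″) , ℕ.≤-refl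

  ∈-primes⁺ : ∀ N {r} {P : Code r} → IsPrime r (poly P) → r ≤ N → (r , P) ∈ primes N
  ∈-primes⁺ zero    pP r≤N = contradiction (ℕ.≤-trans (positive pP) r≤N) λ ()
  ∈-primes⁺ (suc N) pP r≤N with ℕ.m≤n⇒m<n∨m≡n r≤N
  ... | inj₁ (s≤s r≤N′) = ∈-++⁺ˡ (∈-primes⁺ N pP r≤N′)
  ... | inj₂ ≡.refl     = ∈-++⁺ʳ (primes N) (∈-map⁺ (suc N ,_) (∈-filter⁺ prime? (∈-codes _) pP))

  primes-unique : ∀ N → Unique (primes N)
  primes-unique zero    = []
  primes-unique (suc N) = Unique.++⁺ (primes-unique N)
    (Unique.map⁺ (λ { ≡.refl → ≡.refl }) (Unique.filter⁺ prime? (codes-unique (suc N))))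
    (λ { {r , P} (P∈ , P∈′) → disjoint P∈ (∈-map⁻ (suc N ,_) P∈′) })
    where
    disjoint : ∀ {x} → x ∈ primes N → ¬ (∃ λ P → P ∈ filter prime? (codes (suc N)) × x ≡ (suc N , P))
    disjoint P∈ (P , _ , ≡.refl) = ℕ.<-irrefl ≡.refl (proj₂ (∈-primes⁻ N P∈))

  -- Strong induction on the degree: removing one prime factor `Q` lowers only the multiplicity of
  -- `Q`, by one, and the sum by its degree.
  degree-sum : ∀ N n → n ≤ N → (f : Code n) → ∑ (primes N) (λ (r , P) → r ℕ.* mult N P (poly f)) ≡ n
  degree-sum N = <-rec _ go
    where
    go : ∀ n → (∀ {k} → k < n → k ≤ N → (f : Code k) → ∑ (primes N) (λ (r , P) → r ℕ.* mult N P (poly f)) ≡ k) →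
         n ≤ N → (f : Code n) → ∑ (primes N) (λ (r , P) → r ℕ.* mult N P (poly f)) ≡ n
    go zero    rec n≤N f = ≡.trans (∑-cong (primes N) λ { {r , P} P∈ →
      ≡.trans (≡.cong (r ℕ.*_) (mult-constant {N = N} (proj₁ (∈-primes⁻ N P∈)) (poly-monic f))) (ℕ.*-zeroʳ r) })
      (∑-zero (primes N))
    go (suc n) rec (s≤s {n = N′} n≤N) f with prime-factor (suc n) f (s≤s z≤n)
    ... | r , Q , pQ , Q∣f = begin
        ∑ (primes N) (λ (s , P) → s ℕ.* mult N P (poly f))
          ≡⟨ ∑-bump r (primes-unique N) (∈-primes⁺ N pQ r≤N) at-Q elsewhere ⟩
        r ℕ.+ ∑ (primes N) (λ (s , P) → s ℕ.* mult N P (poly g))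
          ≡⟨ ≡.cong (r ℕ.+_) (rec (s≤s k≤n) (ℕ.m≤n⇒m≤1+n (ℕ.≤-trans k≤n n≤N)) g) ⟩
        r ℕ.+ k ≡⟨ eq ⟩
        suc n   ∎
      where
      open ≡.≡-Reasoning
      r≤1+n : r ≤ suc n
      r≤1+n = monic-∣-degree (monic pQ) (poly-monic f) Q∣f
      r≤N : r ≤ N
      r≤N = ℕ.≤-trans r≤1+n (s≤s n≤N)
      k = suc n ℕ.∸ r
      eq : r ℕ.+ k ≡ suc n
      eq = ℕ.m+[n∸m]≡n r≤1+n
      k≤n : k ≤ n
      k≤n = ℕ.≤-pred (≡.subst (suc k ≤_) eq (ℕ.+-monoˡ-≤ k (positive pQ)))
      g : Code k
      g = proj₁ (cofactor (monic pQ) eq f Q∣f)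
      f≋ : poly f ≋ (poly Q *P poly g)
      f≋ = R.trans (R.reflexive (≡.cong poly (≡.sym (proj₂ (cofactor (monic pQ) eq f Q∣f)))))
             (poly-multiple (monic pQ) eq g)
      mult-f : ∀ {s} (P : Code s) → mult N P (poly f) ≡ mult N P (poly Q *P poly g)
      mult-f P = mult-cong N P _ _ (λ _ → ∣ˡ-respʳ-≈ f≋) (λ _ → ∣ˡ-respʳ-≈ (R.sym f≋))
      -- With N = N′ + 1, `mult-same` leaves the multiplicity in `g` at cut-off `N′`; as deg g ≤ N′,
      -- it is the same at `N`.
      at-Q : r ℕ.* mult N Q (poly f) ≡ r ℕ.+ r ℕ.* mult N Q (poly g)
      at-Q = ≡.trans (≡.cong (r ℕ.*_) (≡.trans (mult-f Q) (≡.trans (mult-same N′ {Q} (poly g))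
        (≡.cong suc (≡.sym (mult-top {N = N′} pQ (poly-monic g) (ℕ.≤-trans k≤n n≤N))))))) (ℕ.*-suc r _)
      elsewhere : ∀ {x} → x ∈ primes N → x ≢ (r , Q) →
                  proj₁ x ℕ.* mult N (proj₂ x) (poly f) ≡ proj₁ x ℕ.* mult N (proj₂ x) (poly g)
      elsewhere {s , P} x∈ x≢ = ≡.cong (s ℕ.*_)
        (≡.trans (mult-f P) (mult-other N (poly g) (proj₁ (∈-primes⁻ N x∈)) pQ x≢))

  -- The Kronecker delta, by the same recursion as `multiples`, so that `multiples-suc` follows it
  -- structurally.
  δ : ℕ → ℕ → ℕ
  δ zero    zero    = 1
  δ zero    (suc j) = 0
  δ (suc n) zero    = 0
  δ (suc n) (suc j) = δ n j

  δ-refl : ∀ n → δ n n ≡ 1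
  δ-refl zero    = ≡.refl
  δ-refl (suc n) = δ-refl n

  δ≤1 : ∀ n j → δ n j ≤ 1
  δ≤1 zero    zero    = ℕ.≤-refl
  δ≤1 zero    (suc j) = z≤n
  δ≤1 (suc n) zero    = z≤n
  δ≤1 (suc n) (suc j) = δ≤1 n j

  δ-≢ : ∀ {n j} → n ≢ j → δ n j ≡ 0
  δ-≢ {zero}  {zero}  n≢j = contradiction ≡.refl n≢j
  δ-≢ {zero}  {suc j} n≢j = ≡.refl
  δ-≢ {suc n} {zero}  n≢j = ≡.refl
  δ-≢ {suc n} {suc j} n≢j = δ-≢ (n≢j ∘ ≡.cong suc)

  -- Raising the degree by one multiplies the number of cofactors by q, except at j = n + 1, where
  -- the count rises from 0 to 1.
  multiples-suc : ∀ n j → multiples (suc n) j ≡ q ℕ.* multiples n j ℕ.+ δ (suc n) j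
  multiples-suc n       zero          = ≡.sym (ℕ.+-identityʳ _)
  multiples-suc zero    (suc zero)    = ≡.sym (≡.cong (ℕ._+ 1) (ℕ.*-zeroʳ q))
  multiples-suc zero    (suc (suc j)) = ≡.sym (≡.trans (ℕ.+-identityʳ _) (ℕ.*-zeroʳ q))
  multiples-suc (suc n) (suc j)       = multiples-suc n j

  -- Contributions of one prime of degree `r`, over its exponents from 1 to `N`: the number of pairs
  -- of an exponent i and a monic multiple of P^i of degree `n`, and the number of i with i r = n.
  multiplesSum δSum : ℕ → ℕ → ℕ → ℕ
  multiplesSum n zero    r = 0
  multiplesSum n (suc N) r = multiplesSum n N r ℕ.+ multiples n (suc N ℕ.* r)
  δSum n zero    r = 0
  δSum n (suc N) r = δSum n N r ℕ.+ δ n (suc N ℕ.* r)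

  multiplesSum-suc : ∀ n N r → multiplesSum (suc n) N r ≡ q ℕ.* multiplesSum n N r ℕ.+ δSum (suc n) N r
  multiplesSum-suc n zero    r = ≡.sym (≡.trans (ℕ.+-identityʳ _) (ℕ.*-zeroʳ q))
  multiplesSum-suc n (suc N) r = begin
    multiplesSum (suc n) N r ℕ.+ multiples (suc n) j
      ≡⟨ ≡.cong₂ ℕ._+_ (multiplesSum-suc n N r) (multiples-suc n j) ⟩
    (q ℕ.* multiplesSum n N r ℕ.+ δSum (suc n) N r) ℕ.+ (q ℕ.* multiples n j ℕ.+ δ (suc n) j)
      ≡⟨ ℕ+.interchange (q ℕ.* multiplesSum n N r) (δSum (suc n) N r) (q ℕ.* multiples n j) (δ (suc n) j) ⟩
    (q ℕ.* multiplesSum n N r ℕ.+ q ℕ.* multiples n j) ℕ.+ (δSum (suc n) N r ℕ.+ δ (suc n) j)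
      ≡⟨ ≡.cong (ℕ._+ (δSum (suc n) N r ℕ.+ δ (suc n) j)) (ℕ.*-distribˡ-+ q (multiplesSum n N r) (multiples n j)) ⟨
    q ℕ.* multiplesSum n (suc N) r ℕ.+ δSum (suc n) (suc N) r ∎
    where
    open ≡.≡-Reasoning
    j = suc N ℕ.* r

  mult-sum : ∀ {r} n N (P : Code r) → ∑ (codes n) (λ f → mult N P (poly f)) ≡ multiplesSum n N r
  mult-sum n zero    P = ∑-zero (codes n)
  mult-sum n (suc N) P = ≡.trans (∑-+ (codes n) _ _)
    (≡.cong₂ ℕ._+_ (mult-sum n N P) (count-multiples n (pow-monic (poly-monic P) (suc N))))

  total-degree : ∀ N n → n ≤ N → ∑ (primes N) (λ (r , P) → r ℕ.* multiplesSum n N r) ≡ n ℕ.* q ^ n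
  total-degree N n n≤N = begin
    ∑ (primes N) (λ (r , P) → r ℕ.* multiplesSum n N r)
      ≡⟨ ∑-cong (primes N) (λ { {r , P} _ → ≡.cong (r ℕ.*_) (mult-sum n N P) }) ⟨
    ∑ (primes N) (λ (r , P) → r ℕ.* ∑ (codes n) (λ f → mult N P (poly f)))
      ≡⟨ ∑-cong (primes N) (λ { {r , P} _ → ∑-* (codes n) r (λ f → mult N P (poly f)) }) ⟨
    ∑ (primes N) (λ (r , P) → ∑ (codes n) (λ f → r ℕ.* mult N P (poly f)))
      ≡⟨ ∑-swap (primes N) (codes n) (λ (r , P) f → r ℕ.* mult N P (poly f)) ⟩
    ∑ (codes n) (λ f → ∑ (primes N) (λ (r , P) → r ℕ.* mult N P (poly f)))
      ≡⟨ ∑-cong (codes n) (λ {f} _ → degree-sum N n n≤N f) ⟩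
    ∑ (codes n) (λ _ → n) ≡⟨ ∑-const (codes n) n ⟩
    length (codes n) ℕ.* n ≡⟨ ≡.cong (ℕ._* n) (length-codes n) ⟩
    q ^ n ℕ.* n ≡⟨ ℕ.*-comm (q ^ n) n ⟩
    n ℕ.* q ^ n ∎
    where open ≡.≡-Reasoning

  -- The difference of total-degree at suc n and q times total-degree at n.
  prime-power-count : ∀ N n → suc n ≤ N → ∑ (primes N) (λ (r , P) → r ℕ.* δSum (suc n) N r) ≡ q ^ suc n
  prime-power-count N n n<N = ℕ.+-cancelˡ-≡ (n ℕ.* q ^ suc n) _ _ (begin
    n ℕ.* q ^ suc n ℕ.+ D             ≡⟨ ≡.cong (ℕ._+ D) (ℕ*.x∙yz≈y∙xz n q (q ^ n)) ⟩
    q ℕ.* (n ℕ.* q ^ n) ℕ.+ D         ≡⟨ ≡.cong (λ x → q ℕ.* x ℕ.+ D) (total-degree N n (ℕ.<⇒≤ n<N)) ⟨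
    q ℕ.* ∑ (primes N) M ℕ.+ D        ≡⟨ ≡.cong (ℕ._+ D) (∑-* (primes N) q M) ⟨
    ∑ (primes N) (λ x → q ℕ.* M x) ℕ.+ D ≡⟨ ∑-+ (primes N) (λ x → q ℕ.* M x) _ ⟨
    ∑ (primes N) (λ (r , P) → q ℕ.* (r ℕ.* multiplesSum n N r) ℕ.+ r ℕ.* δSum (suc n) N r)
      ≡⟨ ∑-cong (primes N) (λ { {r , P} _ → pointwise r }) ⟨
    ∑ (primes N) (λ (r , P) → r ℕ.* multiplesSum (suc n) N r) ≡⟨ total-degree N (suc n) n<N ⟩
    suc n ℕ.* q ^ suc n               ≡⟨ ℕ.+-comm (q ^ suc n) _ ⟩
    n ℕ.* q ^ suc n ℕ.+ q ^ suc n     ∎)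
    where
    open ≡.≡-Reasoning
    D = ∑ (primes N) (λ (r , P) → r ℕ.* δSum (suc n) N r)
    M : ∃ Code → ℕ
    M (r , P) = r ℕ.* multiplesSum n N r
    pointwise : ∀ r → r ℕ.* multiplesSum (suc n) N r ≡ q ℕ.* (r ℕ.* multiplesSum n N r) ℕ.+ r ℕ.* δSum (suc n) N r
    pointwise r = ≡.trans (≡.cong (r ℕ.*_) (multiplesSum-suc n N r)) (≡.trans
      (ℕ.*-distribˡ-+ r (q ℕ.* multiplesSum n N r) (δSum (suc n) N r))
      (≡.cong (ℕ._+ r ℕ.* δSum (suc n) N r) (ℕ*.x∙yz≈y∙xz r q (multiplesSum n N r))))

  δ≤δSum : ∀ n N r → δ n r ≤ δSum n (suc N) r
  δ≤δSum n zero    r = ℕ.≤-reflexive (≡.cong (δ n) (≡.sym (ℕ.+-identityʳ r)))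
  δ≤δSum n (suc N) r = ℕ.≤-trans (δ≤δSum n N r) (ℕ.m≤m+n _ _)

  -- Only exponent 1 is kept from `prime-power-count`, that is, the primes of degree exactly n + 1.
  degree-count-≤ : ∀ N n → suc n ≤ N → ∑ (primes N) (λ (r , P) → r ℕ.* δ (suc n) r) ≤ q ^ suc n
  degree-count-≤ (suc N) n n<N = ℕ.≤-trans
    (∑-mono (primes (suc N)) λ { {r , P} _ → ℕ.*-monoʳ-≤ r (δ≤δSum (suc n) N r) })
    (ℕ.≤-reflexive (prime-power-count (suc N) n n<N))

  δSum-small : ∀ n N r → N ℕ.* r < n → δSum n N r ≡ 0
  δSum-small n zero    r _  = ≡.refl
  δSum-small n (suc N) r lt = ≡.cong₂ ℕ._+_
    (δSum-small n N r (ℕ.≤-<-trans (ℕ.m≤n+m (N ℕ.* r) r) lt))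
    (δ-≢ {n} {suc N ℕ.* r} λ { ≡.refl → ℕ.<-irrefl ≡.refl lt })

  -- Since r is positive, at most one exponent i satisfies i r = n.
  δSum≤1 : ∀ n N {r} → 1 ≤ r → δSum n N r ≤ 1
  δSum≤1 n zero    1≤r = z≤n
  δSum≤1 n (suc N) {r} 1≤r with n ℕ.≟ suc N ℕ.* r
  ... | no n≢    = ≡.subst (_≤ 1) (≡.sym (≡.trans (≡.cong (δSum n N r ℕ.+_) (δ-≢ n≢)) (ℕ.+-identityʳ _))) (δSum≤1 n N 1≤r)
  ... | yes ≡.refl = ≡.subst (λ x → x ℕ.+ δ n (suc N ℕ.* r) ≤ 1)
        (≡.sym (δSum-small (r ℕ.+ N ℕ.* r) N r (ℕ.+-monoˡ-≤ (N ℕ.* r) 1≤r))) (δ≤1 n (suc N ℕ.* r))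

  -- Runs from 1 to the bound, both included; index 0 is left out because primes have positive
  -- degree.
  belowSum : (ℕ → ℕ) → ℕ → ℕ
  belowSum f zero    = 0
  belowSum f (suc k) = belowSum f k ℕ.+ f (suc k)

  belowSum-δ : ∀ k {r} → 1 ≤ r → r ≤ k → 1 ≤ belowSum (λ j → δ j r) k
  belowSum-δ zero    1≤r r≤k = ℕ.≤-trans 1≤r r≤k
  belowSum-δ (suc k) 1≤r r≤k with ℕ.m≤n⇒m<n∨m≡n r≤k
  ... | inj₁ (s≤s r≤k′) = ℕ.≤-trans (belowSum-δ k 1≤r r≤k′) (ℕ.m≤m+n _ _)
  ... | inj₂ ≡.refl     = ℕ.≤-trans (ℕ.≤-reflexive (≡.sym (δ-refl k))) (ℕ.m≤n+m _ (belowSum (λ j → δ j (suc k)) k))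

  -- The inner sum of deltas marks the primes of degree at most `k`; each degree j among these
  -- contributes at most q^j.
  small-degrees-≤ : ∀ N k → k ≤ N →
    ∑ (primes N) (λ (r , P) → r ℕ.* belowSum (λ j → δ j r) k) ≤ belowSum (q ^_) k
  small-degrees-≤ N zero    k≤N = ℕ.≤-reflexive (≡.trans (∑-cong (primes N) λ { {r , P} _ → ℕ.*-zeroʳ r }) (∑-zero (primes N)))
  small-degrees-≤ N (suc k) k<N = begin
    ∑ (primes N) (λ (r , P) → r ℕ.* (belowSum (λ j → δ j r) k ℕ.+ δ (suc k) r))
      ≡⟨ ∑-cong (primes N) (λ { {r , P} _ → ℕ.*-distribˡ-+ r _ (δ (suc k) r) }) ⟩
    ∑ (primes N) (λ (r , P) → r ℕ.* belowSum (λ j → δ j r) k ℕ.+ r ℕ.* δ (suc k) r)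
      ≡⟨ ∑-+ (primes N) (λ (r , P) → r ℕ.* belowSum (λ j → δ j r) k) (λ (r , P) → r ℕ.* δ (suc k) r) ⟩
    ∑ (primes N) (λ (r , P) → r ℕ.* belowSum (λ j → δ j r) k) ℕ.+ ∑ (primes N) (λ (r , P) → r ℕ.* δ (suc k) r)
      ≤⟨ ℕ.+-mono-≤ (small-degrees-≤ N k (ℕ.<⇒≤ k<N)) (degree-count-≤ N k k<N) ⟩
    belowSum (q ^_) (suc k) ∎
    where open ℕ.≤-Reasoning

  1<q : 1 < q
  1<q = two (idx 0#) (idx 1#) λ e → 1≉0 (sym (idx-injective e))
    where
    two : ∀ {k} (i j : Fin k) → i ≢ j → 1 < k
    two {suc (suc k)} i    j    i≢j = s≤s (s≤s z≤n)
    two {suc zero}    zero zero i≢j = contradiction ≡.refl i≢j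

  -- By induction the sum is less than twice its last power, and 2 ≤ q.
  geometric : ∀ k → belowSum (q ^_) k < q ^ suc k
  geometric zero    = ℕ.≤-trans (ℕ.<⇒≤ 1<q) (ℕ.≤-reflexive (≡.sym (ℕ.*-identityʳ q)))
  geometric (suc k) = begin-strict
    belowSum (q ^_) k ℕ.+ q ^ suc k <⟨ ℕ.+-monoˡ-< (q ^ suc k) (geometric k) ⟩
    q ^ suc k ℕ.+ q ^ suc k         ≡⟨ ≡.cong (q ^ suc k ℕ.+_) (ℕ.+-identityʳ (q ^ suc k)) ⟨
    2 ℕ.* q ^ suc k                 ≤⟨ ℕ.*-monoˡ-≤ (q ^ suc k) 1<q ⟩
    q ^ suc (suc k)                 ∎
    where open ℕ.≤-Reasoning

  opaque
    prime-exists : ∀ n → ∃ λ (P : Code (suc n)) → IsPrime (suc n) (poly P)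
    prime-exists n with ∃code? (prime? {suc n})
    ... | yes P = P
    ... | no none = contradiction (begin
        q ^ suc n ≡⟨ prime-power-count (suc n) n ℕ.≤-refl ⟨
        ∑ (primes (suc n)) (λ (r , P) → r ℕ.* δSum (suc n) (suc n) r)
          ≤⟨ ∑-mono (primes (suc n)) (λ { {r , P} P∈ → ℕ.*-monoʳ-≤ r (bound P∈) }) ⟩
        ∑ (primes (suc n)) (λ (r , P) → r ℕ.* belowSum (λ j → δ j r) n)
          ≤⟨ small-degrees-≤ (suc n) n (ℕ.n≤1+n n) ⟩
        belowSum (q ^_) n ∎) (ℕ.<⇒≱ (geometric n))
      where
      open ℕ.≤-Reasoning
      -- If degree n + 1 has no irreducible, every listed prime has degree at most n; the left side
      -- is then at most 1 and the right side at least 1.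
      bound : ∀ {r P} → (r , P) ∈ primes (suc n) → δSum (suc n) (suc n) r ≤ belowSum (λ j → δ j r) n
      bound P∈ with ∈-primes⁻ (suc n) P∈
      ... | pP , r≤N with ℕ.m≤n⇒m<n∨m≡n r≤N
      ...   | inj₁ (s≤s r≤n) = ℕ.≤-trans (δSum≤1 (suc n) (suc n) (positive pP)) (belowSum-δ n (positive pP) r≤n)
      ...   | inj₂ ≡.refl    = contradiction (_ , pP) none

-- Polynomials over the field with two elements.

Fin2-cases : ∀ {k} → k ≡ 2 → {i j : Fin k} → i ≢ j → ∀ a → a ≡ i ⊎ a ≡ j
Fin2-cases ≡.refl {zero}     {zero}     i≢j a          = contradiction ≡.refl i≢j
Fin2-cases ≡.refl {suc zero} {suc zero} i≢j a          = contradiction ≡.refl i≢j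
Fin2-cases ≡.refl {zero}     {suc zero} i≢j zero       = inj₁ ≡.refl
Fin2-cases ≡.refl {zero}     {suc zero} i≢j (suc zero) = inj₂ ≡.refl
Fin2-cases ≡.refl {suc zero} {zero}     i≢j zero       = inj₂ ≡.refl
Fin2-cases ≡.refl {suc zero} {zero}     i≢j (suc zero) = inj₁ ≡.refl

module Binary {q : ℕ} {c ℓ : Level} (F : FiniteField q c ℓ) (q≡2 : q ≡ 2) where
  open FiniteField F
  open Poly F
  open PolyRing F
  open Degree F
  open Divisibility F
  private
    module R = CommutativeRing polyRing

  zero-or-one : ∀ x → x ≈ 0# ⊎ x ≈ 1#
  zero-or-one x with Fin2-cases q≡2 {idx 0#} {idx 1#} (λ e → 1≉0 (sym (idx-injective e))) (idx x)
  ... | inj₁ e = inj₁ (idx-injective e)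
  ... | inj₂ e = inj₂ (idx-injective e)

  1+1≈0 : 1# + 1# ≈ 0#
  1+1≈0 with zero-or-one (1# + 1#)
  ... | inj₁ e = e
  ... | inj₂ e = contradiction (∙-cancelˡ 1# 1# 0# (trans e (sym (+-identityʳ 1#)))) 1≉0
    where open GroupProperties +-group using (∙-cancelˡ)

  X-monic : IsMonic 1 X
  X-monic = monic-∷ monic-1

  X+1-monic : IsMonic 1 X+1
  X+1-monic = monic-∷ monic-1

  linear : ∀ {y} → IsMonic 1 y → y ≋ X ⊎ y ≋ X+1
  linear {y} my with toMonic 1 y my
  ... | a ∷ [] , e with zero-or-one a
  ...   | inj₁ a≈0 = inj₁ (R.trans (R.sym e) (∷-cong a≈0 R.refl))
  ...   | inj₂ a≈1 = inj₂ (R.trans (R.sym e) (∷-cong a≈1 R.refl))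

  X-coprime-X+1 : Coprime X X+1
  X-coprime-X+1 = mk (-P [ 1# ]) [ 1# ] (begin
    ((X *P (-P [ 1# ])) +P (X+1 *P [ 1# ])) ≈⟨ R.+-cong (R.sym (-‿distribʳ-* X [ 1# ])) (R.*-identityʳ X+1) ⟩
    ((-P (X *P [ 1# ])) +P X+1)             ≈⟨ R.+-cong (-P-cong (R.*-identityʳ X)) X+1≋ ⟩
    ((-P X) +P (X +P [ 1# ]))               ≈⟨ R.+-assoc (-P X) X [ 1# ] ⟨
    (((-P X) +P X) +P [ 1# ])               ≈⟨ R.+-congʳ (R.-‿inverseˡ X) ⟩
    [ 1# ]                                  ∎)
    where
    open SetoidReasoning R.setoid
    open RingProperties R.ring using (-‿distribʳ-*)
    X+1≋ : X+1 ≋ (X +P [ 1# ])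
    X+1≋ = ∷-cong (sym (+-identityˡ 1#)) R.refl

  prime-no-linear-factor : ∀ {P g} → IsPrime 2 P → IsMonic 1 g → ¬ g ∣ P
  prime-no-linear-factor pP mg g∣P with irreducible pP mg g∣P
  ... | inj₁ ()
  ... | inj₂ ()

  -- Of the polynomials b + a X + X², those with b = 0 have the factor X, and 1 + X² is the square
  -- of X + 1 because 1 + 1 = 0.
  quadratic-prime : ∀ {P} → IsPrime 2 P → P ≋ X²+X+1
  quadratic-prime {P} pP with toMonic 2 P (monic pP)
  ... | b ∷ a ∷ [] , e with zero-or-one b | zero-or-one a
  ...   | inj₂ b≈1 | inj₂ a≈1 = R.trans (R.sym e) (∷-cong b≈1 (∷-cong a≈1 R.refl))
  ...   | inj₁ b≈0 | _        = contradiction (a ∷ 1# ∷ [] , R.trans X* e) (prime-no-linear-factor pP X-monic)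
    where
    X* : (X *P (a ∷ 1# ∷ [])) ≋ (b ∷ a ∷ 1# ∷ [])
    X* = R.trans (0∷-*P [ 1# ] (a ∷ 1# ∷ [])) (∷-cong (sym b≈0) (R.*-identityˡ (a ∷ 1# ∷ [])))
  ...   | inj₂ b≈1 | inj₁ a≈0 = contradiction (X+1 , R.trans square e) (prime-no-linear-factor pP X+1-monic)
    where
    square : (X+1 *P X+1) ≋ (b ∷ a ∷ 1# ∷ [])
    square = R.trans (R.+-cong (1·-identity X+1) (∷-cong refl (R.*-identityˡ X+1)))
      (∷-cong (trans (+-identityʳ 1#) (sym b≈1)) (∷-cong (trans 1+1≈0 (sym a≈0)) R.refl))

-- The pigeonhole principle for relations.

module Pigeonhole {a b r} {A : Set a} {B : Set b} (R : A → B → Set r) {xs : List A} {ys : List B}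
  (unique : Unique xs)
  (related : ∀ {x} → x ∈ xs → ∃ λ y → y ∈ ys × R x y)
  (injective : ∀ {x x' y} → x ∈ xs → x' ∈ xs → R x y → R x' y → x ≡ x') where

  private
    -- One chosen partner for each element of `zs`. The relation may offer several partners; the
    -- choices are distinct because no partner is shared by two elements.
    Image : List A → Set _
    Image zs = ∃ λ ws → Unique ws × length ws ≡ length zs ×
                 (∀ {w} → w ∈ ws → w ∈ ys × ∃ λ z → z ∈ zs × R z w)

    image : ∀ zs → Unique zs → (∀ {z} → z ∈ zs → z ∈ xs) → Image zs
    image []       _        _   = [] , [] , ≡.refl , λ ()
    image (z ∷ zs) (z∉ ∷ u) sub with image zs u (sub ∘ there) | related (sub (here ≡.refl))
    ... | ws , uw , len , back | w , w∈ys , rzw = w ∷ ws , (All.tabulate fresh ∷ uw) , ≡.cong suc len , back′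
      where
      fresh : ∀ {v} → v ∈ ws → w ≢ v
      fresh v∈ ≡.refl with back v∈
      ... | _ , z' , z'∈ , rz'w =
        All.lookup z∉ z'∈ (injective (sub (here ≡.refl)) (sub (there z'∈)) rzw rz'w)
      back′ : ∀ {v} → v ∈ w ∷ ws → v ∈ ys × ∃ λ z' → z' ∈ z ∷ zs × R z' v
      back′ (here ≡.refl) = w∈ys , z , here ≡.refl , rzw
      back′ (there v∈) with back v∈
      ... | v∈ys , z' , z'∈ , rz'v = v∈ys , z' , there z'∈ , rz'v

    full-image : Image xs
    full-image = image xs unique (λ x∈ → x∈)

  opaque
    length-≤ : length xs ≤ length ys
    length-≤ with full-image
    ... | ws , uw , len , back = ≡.subst (_≤ length ys) len (unique-⊆-length uw (proj₁ ∘ back))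

  opaque
    surjective : DecidableEquality B → length ys ≤ length xs → ∀ {y} → y ∈ ys → ∃ λ x → x ∈ xs × R x y
    surjective _≟_ le y∈ with full-image
    ... | ws , uw , len , back =
      proj₂ (back (unique-⊆-full _≟_ uw (proj₁ ∘ back) (≡.subst (length ys ≤_) (≡.sym len) le) y∈))

module _ {a} {A : Set a} where

  opaque
    constant-or-distinct : DecidableEquality A → ∀ xs {x : A} → x ∈ xs →
      (∀ {y} → y ∈ xs → y ≡ x) ⊎ ∃₂ λ y z → y ∈ xs × z ∈ xs × y ≢ z
    constant-or-distinct _≟_ xs {x} x∈ with Any.any? (λ y → ¬? (y ≟ x)) xs
    ... | yes a = let y , y∈ , y≢x = find a in inj₂ (y , x , y∈ , x∈ , y≢x)
    ... | no none = inj₁ λ {y} y∈ → decidable-stable (y ≟ x) λ y≢x → none (lose y∈ y≢x)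

  length-≤1⇒≡ : ∀ {xs} {x y : A} → length xs ≤ 1 → x ∈ xs → y ∈ xs → x ≡ y
  length-≤1⇒≡ {_ ∷ []}    _         (here ≡.refl) (here ≡.refl) = ≡.refl
  length-≤1⇒≡ {_ ∷ _ ∷ _} (s≤s ())

opaque
  -- The right side is at most 2 q^k, so q ≤ 2; with q = 2 there is no slack, and neither exponent
  -- can be below `k`.
  tight : ∀ {q a b k} → 1 < q → a ≤ k → b ≤ k → q ^ suc k ≤ q ^ a ℕ.+ q ^ b → q ≡ 2 × a ≡ k × b ≡ k
  tight {q} {a} {b} {k} 1<q a≤k b≤k le = q≡2 , exponent a≤k left , exponent b≤k right
    where
    instance
      q≢0 : ℕ.NonZero q
      q≢0 = ℕ.>-nonZero (ℕ.<⇒≤ 1<q)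
      q^k≢0 : ℕ.NonZero (q ^ k)
      q^k≢0 = ℕ.m^n≢0 q k
    double : q ^ k ℕ.+ q ^ k ≡ 2 ℕ.* q ^ k
    double = ≡.cong (q ^ k ℕ.+_) (≡.sym (ℕ.+-identityʳ (q ^ k)))
    double≤ : q ^ k ℕ.+ q ^ k ≤ q ^ a ℕ.+ q ^ b
    double≤ = ℕ.≤-trans (ℕ.≤-trans (ℕ.≤-reflexive double) (ℕ.*-monoˡ-≤ (q ^ k) 1<q)) le
    q≡2 : q ≡ 2
    q≡2 = ℕ.≤-antisym (ℕ.*-cancelʳ-≤ q 2 (q ^ k) (ℕ.≤-trans le (ℕ.≤-trans
      (ℕ.+-mono-≤ (ℕ.^-monoʳ-≤ q a≤k) (ℕ.^-monoʳ-≤ q b≤k)) (ℕ.≤-reflexive double)))) 1<q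
    left : q ^ k ≤ q ^ a
    left = ℕ.+-cancelʳ-≤ (q ^ k) _ _ (ℕ.≤-trans double≤ (ℕ.+-monoʳ-≤ (q ^ a) (ℕ.^-monoʳ-≤ q b≤k)))
    right : q ^ k ≤ q ^ b
    right = ℕ.+-cancelˡ-≤ (q ^ k) _ _ (ℕ.≤-trans double≤ (ℕ.+-monoˡ-≤ (q ^ b) (ℕ.^-monoʳ-≤ q a≤k)))
    exponent : ∀ {i} → i ≤ k → q ^ k ≤ q ^ i → i ≡ k
    exponent i≤k le′ with ℕ.m≤n⇒m<n∨m≡n i≤k
    ... | inj₂ eq  = eq
    ... | inj₁ i<k = contradiction le′ (ℕ.<⇒≱ (ℕ.^-monoʳ-< q 1<q i<k))

-- Residues, and strict degree bounds for lcm and gcd.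

module Extremal {q : ℕ} {c ℓ : Level} (F : FiniteField q c ℓ) where
  open FiniteField F using (1#; +-cong; +-identityˡ; -‿cong; -‿inverseʳ; trans)
  open Poly F
  open PolyRing F
  open Degree F
  open Divisibility F
  open Codes F
  open PrimeExistence F using (1<q; ∣-cancel)
  private
    module R = CommutativeRing polyRing
  open GroupProperties R.+-group using (x∙y⁻¹≈ε⇒x≈y)
  open AbelianGroupProperties R.+-abelianGroup using (⁻¹-∙-comm)
  open SetoidReasoning R.setoid

  infixl 6 _-P_
  _-P_ : Poly → Poly → Poly
  f -P g = f +P (-P g)

  monic-difference-bounded : ∀ {n f g} → IsMonic n f → IsMonic n g → Bounded n (f -P g)
  monic-difference-bounded {n} {f} {g} mf mg = bounded-pred
    (trans (coeff-+ f (-P g) n) (trans (+-cong (lead mf) (trans (coeff-neg g n) (-‿cong (lead mg)))) (-‿inverseʳ 1#)))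
    (bounded-+ (bounded mf) (bounded-neg (bounded mg)))

  bounded-+-monic : ∀ {n t g} → Bounded n t → IsMonic n g → IsMonic n (t +P g)
  bounded-+-monic {n} {t} {g} bt mg = mk
    (trans (coeff-+ t g n) (trans (+-cong (vanish bt n ℕ.≤-refl) (lead mg)) (+-identityˡ 1#)))
    (bounded-+ (bounded-mono (ℕ.n≤1+n n) bt) (bounded mg))

  ∣-difference-trans : ∀ {P} f r g → P ∣ (f -P r) → P ∣ (g -P r) → P ∣ (f -P g)
  ∣-difference-trans f r g d d' = ∣-+-cancelˡ d' (∣ˡ-respʳ-≈ (begin
    (f -P r)                   ≈⟨ R.+-congʳ (R.trans (R.+-congˡ {f} (R.-‿inverseˡ g)) (R.+-identityʳ f)) ⟨
    ((f +P ((-P g) +P g)) -P r) ≈⟨ R.+-congʳ (R.+-assoc f (-P g) g) ⟨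
    (((f -P g) +P g) -P r)     ≈⟨ R.+-assoc (f -P g) g (-P r) ⟩
    ((f -P g) +P (g -P r))     ≈⟨ R.+-comm (f -P g) (g -P r) ⟩
    ((g -P r) +P (f -P g))     ∎) d)

  ∣-difference-self : ∀ {P} f → P ∣ (f -P P) → P ∣ f
  ∣-difference-self {P} f d = ∣-+-cancelˡ (∣-neg ∣ˡ-refl) (∣ˡ-respʳ-≈ (R.+-comm f (-P P)) d)

  -- Modulo P every polynomial is congruent to a monic polynomial of degree deg P,
  -- the class of zero being represented by P itself.
  opaque
    residue : ∀ {m P} → IsMonic m P → ∀ f → ∃ λ (r : Code m) → P ∣ (f -P poly r)
    residue {m} {P} mP f with divMod mP f
    ... | s , t , e , bt with code (bounded-+-monic bt mP)
    ...   | r , r≋ = r , ∣ˡ-respʳ-≈ (begin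
        ((P *P s) -P P)                          ≈⟨ R.+-congʳ (R.+-identityʳ (P *P s)) ⟨
        (((P *P s) +P []) -P P)                  ≈⟨ R.+-congʳ (R.+-congˡ {P *P s} (R.-‿inverseʳ t)) ⟨
        (((P *P s) +P (t -P t)) -P P)            ≈⟨ R.+-congʳ (R.+-assoc (P *P s) t (-P t)) ⟨
        ((((P *P s) +P t) -P t) -P P)            ≈⟨ R.+-assoc ((P *P s) +P t) (-P t) (-P P) ⟩
        (((P *P s) +P t) +P ((-P t) -P P))       ≈⟨ R.+-cong (R.sym e) (⁻¹-∙-comm t P) ⟩
        (f -P (t +P P))                          ≈⟨ R.+-congˡ {f} (-P-cong r≋) ⟨
        (f -P poly r)                            ∎) (∣-- (x∣ˡxy P s) ∣ˡ-refl)

  opaque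
    -- With e the gcd, h = e k and h' = e k', the lcm is h k'. Were k' of degree 0, then h' = e
    -- would divide h, which has the same degree, and the two would coincide.
    proper-lcm : ∀ {l} (h h' : Code l) → h ≢ h' →
      ∃₂ λ i k → 1 ≤ i × IsMonic i k × (∀ {f} → poly h ∣ f → poly h' ∣ f → (poly h *P k) ∣ f)
    proper-lcm {l} h h' h≢h' with monic-gcd l (poly h) (poly h') (poly-monic h')
    ... | j , e , me , (k , ek≋h) , (k' , ek'≋h') , s , t , bez = l ℕ.∸ j , k' , positive′ , k'-monic , least
      where
      k'-monic : IsMonic (l ℕ.∸ j) k'
      k'-monic = monic-quotient me (monic-resp (R.sym ek'≋h') (poly-monic h'))
      positive′ : 1 ≤ l ℕ.∸ j
      positive′ with l ℕ.∸ j | k'-monic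
      ... | suc _ | _  = s≤s z≤n
      ... | zero  | mk′ = contradiction (≡.sym (poly-injective
            (monic-∣-≋ (poly-monic h') (poly-monic h) (∣ˡ-respˡ-≈ e≋h' (k , ek≋h))))) h≢h'
        where
        e≋h' : e ≋ poly h'
        e≋h' = R.trans (R.sym (R.*-identityʳ e)) (R.trans (*P-congˡ e (R.sym (monic-0⇒1 mk′))) ek'≋h')
      coprime : Coprime k' k
      coprime = mk t s (monic-cancel me (begin
        (e *P ((k' *P t) +P (k *P s)))         ≈⟨ R.distribˡ e (k' *P t) (k *P s) ⟩
        ((e *P (k' *P t)) +P (e *P (k *P s)))  ≈⟨ R.+-cong (R.*-assoc e k' t) (R.*-assoc e k s) ⟨
        (((e *P k') *P t) +P ((e *P k) *P s))  ≈⟨ R.+-cong (*P-congʳ (e *P k') (poly h') ek'≋h') (*P-congʳ (e *P k) (poly h) ek≋h) ⟩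
        ((poly h' *P t) +P (poly h *P s))      ≈⟨ R.+-comm (poly h' *P t) (poly h *P s) ⟩
        ((poly h *P s) +P (poly h' *P t))      ≈⟨ bez ⟩
        e                                      ≈⟨ R.*-identityʳ e ⟨
        (e *P [ 1# ])                          ∎))
      -- Writing f = h u = e k u, divisibility by h' = e k' leaves k' dividing k u after cancelling
      -- e, hence dividing u.
      least : ∀ {f} → poly h ∣ f → poly h' ∣ f → (poly h *P k') ∣ f
      least {f} (u , hu≋f) h'∣f = ∣ˡ-respʳ-≈ hu≋f (x∣ˡy⇒zx∣ˡzy (poly h) (coprime-∣ {k'} {k} {u} coprime
        (∣-cancel e k' (k *P u) me (∣ˡ-respʳ-≈ f≋eku (∣ˡ-respˡ-≈ (R.sym ek'≋h') h'∣f)))))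
        where
        f≋eku : f ≋ (e *P (k *P u))
        f≋eku = R.trans (R.sym hu≋f) (R.trans (*P-congʳ (poly h) (e *P k) (R.sym ek≋h)) (R.*-assoc e k u))

  opaque
    -- A gcd of degree `n` would equal both monic polynomials.
    proper-gcd : ∀ {n} (f f' : Code n) → f ≢ f' →
      ∃₂ λ k G → k < n × IsMonic k G × (∀ {h} → h ∣ poly f → h ∣ poly f' → h ∣ G)
    proper-gcd {n} f f' f≢f' with monic-gcd n (poly f) (poly f') (poly-monic f')
    ... | k , G , mG , G∣f , G∣f' , s , t , bez = k , G
        , ℕ.≤∧≢⇒< (monic-∣-degree mG (poly-monic f) G∣f) (λ { ≡.refl → f≢f' (poly-injective
            (R.trans (R.sym (monic-∣-≋ mG (poly-monic f) G∣f)) (monic-∣-≋ mG (poly-monic f') G∣f'))) })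
        , mG , λ h∣f h∣f' → ∣ˡ-respʳ-≈ bez (∣-+ (x∣ˡy⇒x∣ˡyz s h∣f) (x∣ˡy⇒x∣ˡyz t h∣f'))

  -- The members divisible by an irreducible of degree m, and the others.

  module Family {n l m' : ℕ} (Pc : Code (suc m')) (P-prime : IsPrime (suc m') (poly Pc))
    (l+m≡n : l ℕ.+ suc m' ≡ n) (1≤l : 1 ≤ l) (fam : List (Code n))
    (unique : Unique fam) (size : length fam ≡ q ^ suc m')
    (common : ∀ {u v} → u ∈ fam → v ∈ fam → ∃₂ λ k g → l ≤ k × IsMonic k g × g ∣ poly u × g ∣ poly v)
    (primary : ∀ {k g} → 1 ≤ k → IsMonic k g → ¬ (∀ {u} → u ∈ fam → g ∣ poly u)) where

    m : ℕ
    m = suc m'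

    m+l≡n : m ℕ.+ l ≡ n
    m+l≡n = ≡.trans (ℕ.+-comm m l) l+m≡n

    P : Poly
    P = poly Pc

    P-monic : IsMonic m P
    P-monic = poly-monic Pc

    P∣? : (w : Code n) → Dec (P ∣ poly w)
    P∣? w = ∣? P-monic (poly w)

    P∤-∣ : ∀ {f g} → ¬ P ∣ f → g ∣ f → ¬ P ∣ g
    P∤-∣ P∤f g∣f P∣g = P∤f (∣ˡ-trans P∣g g∣f)

    -- A common divisor `g` of the two is prime to `P` because P does not divide `u`, so P g divides
    -- the difference, whose degree is below n.
    congruent⇒≡ : ∀ {u v} → u ∈ fam → v ∈ fam → ¬ P ∣ poly u → P ∣ (poly u -P poly v) → u ≡ v
    congruent⇒≡ {u} {v} u∈ v∈ P∤u d with common u∈ v∈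
    ... | k , g , l≤k , mg , g∣u , g∣v = poly-injective (x∙y⁻¹≈ε⇒x≈y (poly u) (poly v)
        (bounded-∣⇒0 (monic-* P-monic mg)
          (bounded-mono (ℕ.≤-trans (ℕ.≤-reflexive (≡.sym m+l≡n)) (ℕ.+-monoʳ-≤ m l≤k))
            (monic-difference-bounded (poly-monic u) (poly-monic v)))
          (coprime-* (prime-coprime P-prime (P∤-∣ P∤u g∣u)) d (∣-- g∣u g∣v))))

    -- The quotients by P of the members divisible by P, and the members not divisible by P.
    opaque
      H₁ : List (Code l)
      H₁ = filter (λ h → Any.any? (multiple P-monic m+l≡n h ≟C_) fam) (codes l)

      F₀ : List (Code n)
      F₀ = filter (λ w → ¬? (P∣? w)) fam

      ∈-H₁⁻ : ∀ {h} → h ∈ H₁ → multiple P-monic m+l≡n h ∈ fam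
      ∈-H₁⁻ h∈ = proj₂ (∈-filter⁻ (λ h → Any.any? (multiple P-monic m+l≡n h ≟C_) fam) {xs = codes l} h∈)

      ∈-H₁⁺ : ∀ {h} → multiple P-monic m+l≡n h ∈ fam → h ∈ H₁
      ∈-H₁⁺ h∈ = ∈-filter⁺ (λ h → Any.any? (multiple P-monic m+l≡n h ≟C_) fam) (∈-codes _) h∈

      H₁-unique : Unique H₁
      H₁-unique = Unique.filter⁺ _ (codes-unique l)

      ∈-F₀⁻ : ∀ {f} → f ∈ F₀ → f ∈ fam × ¬ P ∣ poly f
      ∈-F₀⁻ = ∈-filter⁻ (λ w → ¬? (P∣? w)) {xs = fam}

      F₀-unique : Unique F₀
      F₀-unique = Unique.filter⁺ _ unique

      member : ∀ {f} → f ∈ fam → f ∈ F₀ ⊎ ∃ λ h → h ∈ H₁ × multiple P-monic m+l≡n h ≡ f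
      member {f} f∈ with P∣? f
      ... | no P∤f = inj₁ (∈-filter⁺ (λ w → ¬? (P∣? w)) f∈ P∤f)
      ... | yes P∣f with cofactor P-monic m+l≡n f P∣f
      ...   | h , ≡.refl = inj₂ (h , ∈-H₁⁺ f∈ , ≡.refl)

    opaque
      q^m≤H₁+F₀ : q ^ m ≤ length H₁ ℕ.+ length F₀
      q^m≤H₁+F₀ = ≡.subst₂ _≤_ size
        (≡.trans (List.length-++ (map (multiple P-monic m+l≡n) H₁)) (≡.cong (ℕ._+ length F₀) (List.length-map _ H₁)))
        (unique-⊆-length unique sub)
        where
        sub : ∀ {f} → f ∈ fam → f ∈ map (multiple P-monic m+l≡n) H₁ ++ F₀
        sub f∈ with member f∈
        ... | inj₁ f∈F₀ = ∈-++⁺ʳ (map (multiple P-monic m+l≡n) H₁) f∈F₀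
        ... | inj₂ (h , h∈ , ≡.refl) = ∈-++⁺ˡ (∈-map⁺ (multiple P-monic m+l≡n) h∈)

    opaque
      -- The common divisor `g` of P h and f is prime to `P`, so P g divides P h. Its degree is at
      -- least n, so the two are equal, and cancelling `P` gives g = h.
      H₁∣F₀ : ∀ {h f} → h ∈ H₁ → f ∈ F₀ → poly h ∣ poly f
      H₁∣F₀ {h} {f} h∈ f∈ with ∈-F₀⁻ f∈
      ... | f∈fam , P∤f with common (∈-H₁⁻ h∈) f∈fam
      ...   | k , g , l≤k , mg , g∣Ph , g∣f = ∣ˡ-respˡ-≈ g≋h g∣f
        where
        Pg∣Ph : (P *P g) ∣ poly (multiple P-monic m+l≡n h)
        Pg∣Ph = coprime-* (prime-coprime P-prime (P∤-∣ P∤f g∣f)) (∣-multiple P-monic m+l≡n h) g∣Ph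
        k≡l : k ≡ l
        k≡l = ℕ.≤-antisym (ℕ.+-cancelˡ-≤ m k l (≡.subst (m ℕ.+ k ≤_) (≡.sym m+l≡n)
          (monic-∣-degree (monic-* P-monic mg) (poly-monic (multiple P-monic m+l≡n h)) Pg∣Ph))) l≤k
        Pg-monic : IsMonic n (P *P g)
        Pg-monic = ≡.subst (λ j → IsMonic j (P *P g)) (≡.trans (≡.cong (m ℕ.+_) k≡l) m+l≡n) (monic-* P-monic mg)
        g≋h : g ≋ poly h
        g≋h = monic-cancel P-monic (R.trans (monic-∣-≋ Pg-monic (poly-monic (multiple P-monic m+l≡n h)) Pg∣Ph)
          (poly-multiple P-monic m+l≡n h))

    opaque
      divisible-member : ∃ λ f → f ∈ fam × P ∣ poly f
      divisible-member with Any.any? P∣? fam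
      ... | yes a = find a
      ... | no none = proj₁ found , proj₁ (proj₂ found) , ∣-difference-self (poly (proj₁ found)) (proj₂ (proj₂ found))
        where
        residue-code : ∀ {u} → u ∈ fam → ∃ λ (r : Code m) → r ∈ codes m × P ∣ (poly u -P poly r)
        residue-code {u} _ = let r , d = residue P-monic (poly u) in r , ∈-codes r , d
        residue-injective : ∀ {u v} {r : Code m} → u ∈ fam → v ∈ fam →
          P ∣ (poly u -P poly r) → P ∣ (poly v -P poly r) → u ≡ v
        residue-injective {u} {v} {r} u∈ v∈ d d' = congruent⇒≡ u∈ v∈ (λ P∣u → none (lose u∈ P∣u))
          (∣-difference-trans (poly u) (poly r) (poly v) d d')
        open Pigeonhole (λ u r → P ∣ (poly u -P poly r)) unique residue-code residue-injective
        -- The injection into the q^m classes is onto, so the class of zero, whose representative is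
        -- `P`, is attained as well.
        found : ∃ λ f → f ∈ fam × P ∣ (poly f -P P)
        found = surjective _≟C_ (ℕ.≤-reflexive (≡.trans (length-codes m) (≡.sym size))) (∈-codes Pc)

    opaque
      nondivisible-member : ∃ λ f → f ∈ F₀
      nondivisible-member with F₀ in eq
      ... | f ∷ _ = f , here ≡.refl
      ... | []    = contradiction (λ {u} → divides {u}) (primary (s≤s z≤n) P-monic)
        where
        divides : ∀ {u} → u ∈ fam → P ∣ poly u
        divides u∈ with member u∈
        ... | inj₁ u∈F₀ = contradiction (≡.subst (_ ∈_) eq u∈F₀) λ ()
        ... | inj₂ (h , _ , ≡.refl) = ∣-multiple P-monic m+l≡n h

    -- The generic alternative in terms of codes, with d = m.
    record LcmFamily : Set (c ⊔ ℓ) where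
      field
        H         : Poly
        H-monic   : IsMonic (m ℕ.+ n) H
        H-common  : ∀ (p : Code m) → poly p ∣ H
        H-least   : ∀ M → (∀ (p : Code m) → poly p ∣ M) → H ∣ M
        quotient  : ∀ {f} → f ∈ fam → ∃ λ (p : Code m) → (poly p *P poly f) ≋ H
        quotient⁻ : ∀ {f} (p : Code m) → (poly p *P poly f) ≋ H → f ∈ fam

    -- A single member not divisible by P: the lcm family.

    module _ {f₀} (f₀∈ : f₀ ∈ F₀) (F₀-constant : ∀ {f} → f ∈ F₀ → f ≡ f₀) where
      private
        H₀ : Poly
        H₀ = P *P poly f₀

        H₀-monic : IsMonic (m ℕ.+ n) H₀
        H₀-monic = monic-* P-monic (poly-monic f₀)

        opaque
          complement₀ : ∀ {h} → h ∈ H₁ → ∃ λ (a : Code m) → (poly h *P poly a) ≋ poly f₀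
          complement₀ {h} h∈ =
            let a , e = cofactor (poly-monic h) l+m≡n f₀ (H₁∣F₀ h∈ f₀∈)
            in a , R.trans (R.sym (poly-multiple (poly-monic h) l+m≡n a)) (R.reflexive (≡.cong poly e))

        opaque
          -- If f = P h and f₀ = h a, then a f = P f₀; the quotient sought is the complement `a` of
          -- `h` in f₀.
          quot-P : ∀ {f h} → h ∈ H₁ → multiple P-monic m+l≡n h ≡ f → ∃ λ (p : Code m) → p ∈ codes m × (poly p *P poly f) ≋ H₀
          quot-P {f} {h} h∈ e = a , ∈-codes a , (begin
            (poly a *P poly f)        ≈⟨ *P-congˡ (poly a) (R.trans (R.reflexive (≡.cong poly (≡.sym e))) (poly-multiple P-monic m+l≡n h)) ⟩
            (poly a *P (P *P poly h)) ≈⟨ R.*-comm (poly a) (P *P poly h) ⟩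
            ((P *P poly h) *P poly a) ≈⟨ R.*-assoc P (poly h) (poly a) ⟩
            (P *P (poly h *P poly a)) ≈⟨ *P-congˡ P (proj₂ (complement₀ h∈)) ⟩
            (P *P poly f₀)            ∎)
            where
            a : Code m
            a = proj₁ (complement₀ h∈)

        opaque
          quot : ∀ {f} → f ∈ fam → ∃ λ (p : Code m) → p ∈ codes m × (poly p *P poly f) ≋ H₀
          quot f∈ with member f∈
          ... | inj₁ f∈F₀ = Pc , ∈-codes Pc , *P-congˡ P (R.reflexive (≡.cong poly (F₀-constant f∈F₀)))
          ... | inj₂ (h , h∈ , e) = quot-P h∈ e

        cancel : ∀ {f f' : Code n} (p : Code m) → (poly p *P poly f) ≋ H₀ → (poly p *P poly f') ≋ H₀ → f ≡ f'
        cancel p e e' = poly-injective (monic-cancel (poly-monic p) (R.trans e (R.sym e')))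

        opaque
          surj : ∀ (p : Code m) → ∃ λ f → f ∈ fam × (poly p *P poly f) ≋ H₀
          surj p = Pigeonhole.surjective (λ f p → (poly p *P poly f) ≋ H₀) {ys = codes m} unique quot
            (λ {_} {_} {p} _ _ → cancel p) _≟C_ (ℕ.≤-reflexive (≡.trans (length-codes m) (≡.sym size))) (∈-codes p)

        common-∣ : ∀ (p : Code m) → poly p ∣ H₀
        common-∣ p = let f , _ , e = surj p in poly f , e

        opaque
          -- The gcd `G` of `M` and `H₀` is again a common multiple of all `p`, by Bezout. Each
          -- member H₀ / p equals (G / p) e, where e = H₀ / G.
          least : ∀ M → (∀ (p : Code m) → poly p ∣ M) → H₀ ∣ M
          least M p∣M with monic-gcd (m ℕ.+ n) M H₀ H₀-monic
          ... | k , G , mG , G∣M , (e , Ge≋H) , s , t , bez = ∣ˡ-respˡ-≈ G≋H G∣M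
            where
            p∣G : ∀ (p : Code m) → poly p ∣ G
            p∣G p = ∣ˡ-respʳ-≈ bez (∣-+ (x∣ˡy⇒x∣ˡyz s (p∣M p)) (x∣ˡy⇒x∣ˡyz t (common-∣ p)))
            e-monic : IsMonic ((m ℕ.+ n) ℕ.∸ k) e
            e-monic = monic-quotient mG (monic-resp (R.sym Ge≋H) H₀-monic)
            -- The cofactor of the gcd in H₀ divides every member, so primarity makes it trivial.
            e∣fam : ∀ {f} → f ∈ fam → e ∣ poly f
            e∣fam {f} f∈ with quot f∈
            ... | p , _ , pf≋H with p∣G p
            ...   | u , pu≋G = u , monic-cancel (poly-monic p) (begin
              (poly p *P (e *P u)) ≈⟨ *P-congˡ (poly p) (R.*-comm e u) ⟩
              (poly p *P (u *P e)) ≈⟨ R.*-assoc (poly p) u e ⟨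
              ((poly p *P u) *P e) ≈⟨ *P-congʳ (poly p *P u) G pu≋G ⟩
              (G *P e)             ≈⟨ Ge≋H ⟩
              H₀                   ≈⟨ pf≋H ⟨
              (poly p *P poly f)   ∎)
            e≋1 : e ≋ [ 1# ]
            e≋1 with (m ℕ.+ n) ℕ.∸ k | e-monic
            ... | zero  | me = monic-0⇒1 me
            ... | suc _ | me = contradiction (λ {u} → e∣fam {u}) (primary (s≤s z≤n) me)
            G≋H : G ≋ H₀
            G≋H = R.trans (R.sym (R.*-identityʳ G)) (R.trans (*P-congˡ G (R.sym e≋1)) Ge≋H)

      lcmFamily : LcmFamily
      lcmFamily = record
        { H = H₀ ; H-monic = H₀-monic ; H-common = common-∣ ; H-least = least
        ; quotient = λ f∈ → let p , _ , e = quot f∈ in p , e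
        ; quotient⁻ = λ {f} p e → let f' , f'∈ , e' = surj p in ≡.subst (_∈ fam) (cancel p e' e) f'∈ }

    -- Here `F₀` consists of the products of `L` with linear polynomials and `H₁` of the quotients
    -- of `L` by them. The degree l is still open.
    record ExceptionalFamily : Set (c ⊔ ℓ) where
      field
        q≡2     : q ≡ 2
        m'≡1    : m' ≡ 1
        L       : Poly
        L-monic : IsMonic (suc l) L
        F₀-to   : ∀ {f} → f ∈ F₀ → ∃ λ u → IsMonic 1 u × poly f ≋ (L *P u)
        F₀-from : ∀ {u} → IsMonic 1 u → ∃ λ f → f ∈ F₀ × poly f ≋ (L *P u)
        H₁-to   : ∀ {h} → h ∈ H₁ → ∃ λ y → IsMonic 1 y × (poly h *P y) ≋ L
        H₁-from : ∀ {y} → IsMonic 1 y → ∃ λ h → h ∈ H₁ × (poly h *P y) ≋ L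

    opaque
      H₁-distinct : ∃₂ λ h h' → h ∈ H₁ × h' ∈ H₁ × h ≢ h'
      H₁-distinct with divisible-member
      ... | f , f∈ , P∣f with cofactor P-monic m+l≡n f P∣f
      ...   | h , ≡.refl with constant-or-distinct _≟C_ H₁ (∈-H₁⁺ f∈)
      ...     | inj₂ distinct = distinct
      ...     | inj₁ constant = contradiction (λ {u} → divides {u}) (primary 1≤l (poly-monic h))
        where
        divides : ∀ {u} → u ∈ fam → poly h ∣ poly u
        divides u∈ with member u∈
        ... | inj₁ u∈F₀ = H₁∣F₀ (∈-H₁⁺ f∈) u∈F₀
        ... | inj₂ (h' , h'∈ , ≡.refl) = ∣ˡ-respʳ-≈ (R.sym (poly-multiple P-monic m+l≡n h'))
              (∣-*ˡ P (∣ˡ-reflexive (R.reflexive (≡.cong poly (≡.sym (constant h'∈))))))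

    -- Two quotients and two non-divisible members: the bounds are attained.

    module _ {h h'} (h∈ : h ∈ H₁) (h'∈ : h' ∈ H₁) (h≢h' : h ≢ h')
             {f f'} (f∈ : f ∈ F₀) (f'∈ : f' ∈ F₀) (f≢f' : f ≢ f') where
      private
        lcm-data = proper-lcm h h' h≢h'
        i = proj₁ lcm-data
        k' = proj₁ (proj₂ lcm-data)
        1≤i : 1 ≤ i
        1≤i = proj₁ (proj₂ (proj₂ lcm-data))
        L₀ : Poly
        L₀ = poly h *P k'
        L₀-monic : IsMonic (l ℕ.+ i) L₀
        L₀-monic = monic-* (poly-monic h) (proj₁ (proj₂ (proj₂ (proj₂ lcm-data))))
        L₀∣F₀ : ∀ {f} → f ∈ F₀ → L₀ ∣ poly f
        L₀∣F₀ f∈ = proj₂ (proj₂ (proj₂ (proj₂ lcm-data))) (H₁∣F₀ h∈ f∈) (H₁∣F₀ h'∈ f∈)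

        -- The degree of the cofactor of the lcm `L₀` in a member of `F₀`; as i ≥ 1, it is at most m
        -- - 1.
        b = n ℕ.∸ (l ℕ.+ i)
        l+i+b≡n : (l ℕ.+ i) ℕ.+ b ≡ n
        l+i+b≡n = ℕ.m+[n∸m]≡n (monic-∣-degree L₀-monic (poly-monic f) (L₀∣F₀ f∈))
        i+b≡m : i ℕ.+ b ≡ m
        i+b≡m = ℕ.+-cancelˡ-≡ l _ _ (≡.trans (≡.sym (ℕ.+-assoc l i b)) (≡.trans l+i+b≡n (≡.sym l+m≡n)))
        b≤m' : b ≤ m'
        b≤m' = ℕ.≤-pred (≡.subst (suc b ≤_) i+b≡m (ℕ.+-monoˡ-≤ b 1≤i))

        L₀-cofactor : ∀ {f} → f ∈ F₀ → ∃ λ (u : Code b) → u ∈ codes b × poly f ≋ (L₀ *P poly u)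
        L₀-cofactor {f} f∈ =
          let u , e = cofactor L₀-monic l+i+b≡n f (L₀∣F₀ f∈)
          in u , ∈-codes u , R.trans (R.reflexive (≡.cong poly (≡.sym e))) (poly-multiple L₀-monic l+i+b≡n u)

        L₀-cofactor-injective : ∀ {f f'} {u : Code b} → f ∈ F₀ → f' ∈ F₀ →
          poly f ≋ (L₀ *P poly u) → poly f' ≋ (L₀ *P poly u) → f ≡ f'
        L₀-cofactor-injective _ _ e e' = poly-injective (R.trans e (R.sym e'))

        module F₀-cofactors =
          Pigeonhole (λ f u → poly f ≋ (L₀ *P poly u)) F₀-unique L₀-cofactor L₀-cofactor-injective

        gcd-data = proper-gcd f f' f≢f'
        g = proj₁ gcd-data
        G = proj₁ (proj₂ gcd-data)
        g<n : g < n
        g<n = proj₁ (proj₂ (proj₂ gcd-data))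
        G-monic : IsMonic g G
        G-monic = proj₁ (proj₂ (proj₂ (proj₂ gcd-data)))
        H₁∣G : ∀ {h} → h ∈ H₁ → poly h ∣ G
        H₁∣G h∈ = proj₂ (proj₂ (proj₂ (proj₂ gcd-data))) (H₁∣F₀ h∈ f∈) (H₁∣F₀ h∈ f'∈)

        -- The degree of the cofactor of an h in the gcd `G`; as g < n = l + m, it is at most m - 1.
        a = g ℕ.∸ l
        a≤m' : a ≤ m'
        a≤m' = ℕ.≤-trans (ℕ.∸-monoˡ-≤ l (ℕ.≤-pred (≡.subst (g <_) (≡.trans (≡.sym l+m≡n) (ℕ.+-suc l m')) g<n)))
                 (ℕ.≤-reflexive (ℕ.m+n∸m≡n l m'))

      -- Stated for any common multiple `D` of `H₁`: the gcd `G` gives the upper bound on `H₁`, and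
      -- `L₀` later gives the sharper one that fixes m.
      module Divisors {d D} (D-monic : IsMonic d D) (H₁∣D : ∀ {h} → h ∈ H₁ → poly h ∣ D) where
        opaque
          complement : ∀ {h} → h ∈ H₁ → ∃ λ (y : Code (d ℕ.∸ l)) → y ∈ codes (d ℕ.∸ l) × (poly h *P poly y) ≋ D
          complement {h} h∈ with H₁∣D h∈
          ... | y , e with code (monic-quotient (poly-monic h) (monic-resp (R.sym e) D-monic))
          ...   | w , w≋y = w , ∈-codes w , R.trans (*P-congˡ (poly h) w≋y) e

        complement-injective : ∀ {h h'} {y : Code (d ℕ.∸ l)} → h ∈ H₁ → h' ∈ H₁ →
          (poly h *P poly y) ≋ D → (poly h' *P poly y) ≋ D → h ≡ h'
        complement-injective {h} {h'} {y} _ _ e e' = poly-injective (monic-cancel (poly-monic y) (begin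
          (poly y *P poly h)  ≈⟨ R.*-comm (poly y) (poly h) ⟩
          (poly h *P poly y)  ≈⟨ e ⟩
          D                   ≈⟨ e' ⟨
          (poly h' *P poly y) ≈⟨ R.*-comm (poly h') (poly y) ⟩
          (poly y *P poly h') ∎))

        open Pigeonhole (λ h y → (poly h *P poly y) ≋ D) H₁-unique complement complement-injective public

      private
        F₀≤ : length F₀ ≤ q ^ b
        F₀≤ = ≡.subst (length F₀ ≤_) (length-codes b) F₀-cofactors.length-≤

        H₁≤ : length H₁ ≤ q ^ a
        H₁≤ = ≡.subst (length H₁ ≤_) (length-codes a) (Divisors.length-≤ G-monic H₁∣G)

        extremal : q ≡ 2 × a ≡ m' × b ≡ m'
        extremal = tight 1<q a≤m' b≤m' (ℕ.≤-trans q^m≤H₁+F₀ (ℕ.+-mono-≤ H₁≤ F₀≤))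

        q≡2 = proj₁ extremal
        a≡m' = proj₁ (proj₂ extremal)
        b≡m' = proj₂ (proj₂ extremal)

        -- Since q = 2, the lower bound q^m equals the sum of the two upper bounds, so each of them
        -- is attained.
        2q^m'≤ : q ^ m' ℕ.+ q ^ m' ≤ length H₁ ℕ.+ length F₀
        2q^m'≤ = ℕ.≤-trans (ℕ.≤-reflexive (≡.trans (≡.cong (q ^ m' ℕ.+_) (≡.sym (ℕ.+-identityʳ (q ^ m'))))
          (≡.cong (ℕ._* q ^ m') (≡.sym q≡2)))) q^m≤H₁+F₀

        q^b≤F₀ : q ^ b ≤ length F₀
        q^b≤F₀ = ≡.subst (λ x → q ^ x ≤ length F₀) (≡.sym b≡m') (ℕ.+-cancelˡ-≤ (q ^ m') _ _
          (ℕ.≤-trans 2q^m'≤ (ℕ.+-monoˡ-≤ (length F₀) (≡.subst (λ x → length H₁ ≤ q ^ x) a≡m' H₁≤))))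

        q^m'≤H₁ : q ^ m' ≤ length H₁
        q^m'≤H₁ = ℕ.+-cancelʳ-≤ (q ^ m') _ _
          (ℕ.≤-trans 2q^m'≤ (ℕ.+-monoʳ-≤ (length H₁) (≡.subst (λ x → length F₀ ≤ q ^ x) b≡m' F₀≤)))

        opaque
          F₀-surjective : ∀ {u} → IsMonic b u → ∃ λ f → f ∈ F₀ × poly f ≋ (L₀ *P u)
          F₀-surjective mu =
            let w , e = code mu
                f , f∈ , e' = F₀-cofactors.surjective _≟C_ (≡.subst (_≤ length F₀) (≡.sym (length-codes b)) q^b≤F₀) (∈-codes w)
            in f , f∈ , R.trans e' (*P-congˡ L₀ e)

        -- With b = 0 only the cofactor 1 would remain, and `F₀` would have a single element.
        1≤b : 1 ≤ b
        1≤b with b | F₀≤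
        ... | suc _ | _  = s≤s z≤n
        ... | zero  | le = contradiction (length-≤1⇒≡ le f∈ f'∈) f≢f'

        -- With u and u + 1 both occurring as cofactors, a common divisor of L₀ u and L₀ (u + 1) divides L₀.
        H₁∣L₀ : ∀ {h} → h ∈ H₁ → poly h ∣ L₀
        H₁∣L₀ {h} h∈ = ∣ˡ-respʳ-≈ (R.*-identityʳ L₀) (∣-+-cancelˡ (divides u-monic)
          (∣ˡ-respʳ-≈ (R.trans (R.distribˡ L₀ [ 1# ] u) (R.+-comm (L₀ *P [ 1# ]) (L₀ *P u))) (divides u+1-monic)))
          where
          divides : ∀ {u} → IsMonic b u → poly h ∣ (L₀ *P u)
          divides mu = let f , f∈ , e = F₀-surjective mu in ∣ˡ-respʳ-≈ e (H₁∣F₀ h∈ f∈)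
          u : Poly
          u = poly (proj₁ (L₀-cofactor f∈))
          u-monic : IsMonic b u
          u-monic = poly-monic (proj₁ (L₀-cofactor f∈))
          u+1-monic : IsMonic b ([ 1# ] +P u)
          u+1-monic = bounded-+-monic (bounded-mono 1≤b (bounded monic-1)) u-monic

        i≡1 : i ≡ 1
        i≡1 = ℕ.+-cancelʳ-≡ b i 1 (≡.trans i+b≡m (≡.cong suc (≡.sym b≡m')))

        L₀-monic′ : IsMonic (suc l) L₀
        L₀-monic′ = ≡.subst (λ j → IsMonic j L₀) (≡.trans (≡.cong (l ℕ.+_) i≡1) (ℕ.+-comm l 1)) L₀-monic

        1+l∸l≡1 : suc l ℕ.∸ l ≡ 1
        1+l∸l≡1 = ℕ.m+n∸n≡m 1 l

        module L₀-divisors = Divisors L₀-monic′ H₁∣L₀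

        -- As `L₀` has degree l + 1, the q^m' elements of `H₁` have distinct linear cofactors in it,
        -- so q^m' ≤ q; the other inequality is 1 ≤ b.
        m'≡1 : m' ≡ 1
        m'≡1 = ℕ.≤-antisym
          (ℕ.≮⇒≥ λ 1<m' → ℕ.<⇒≱ (ℕ.^-monoʳ-< q 1<q 1<m') (ℕ.≤-trans q^m'≤H₁
            (≡.subst (length H₁ ≤_) (≡.trans (length-codes (suc l ℕ.∸ l)) (≡.cong (q ^_) 1+l∸l≡1)) L₀-divisors.length-≤)))
          (≡.subst (1 ≤_) b≡m' 1≤b)

        b≡1 : b ≡ 1
        b≡1 = ≡.trans b≡m' m'≡1

      exceptionalFamily : ExceptionalFamily
      exceptionalFamily = record
        { q≡2 = q≡2 ; m'≡1 = m'≡1 ; L = L₀ ; L-monic = L₀-monic′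
        ; F₀-to = λ f∈ → let u , _ , e = L₀-cofactor f∈
                         in poly u , ≡.subst (λ j → IsMonic j (poly u)) b≡1 (poly-monic u) , e
        ; F₀-from = λ {u} mu → F₀-surjective (≡.subst (λ j → IsMonic j u) (≡.sym b≡1) mu)
        ; H₁-to = λ h∈ → let y , _ , e = L₀-divisors.complement h∈
                         in poly y , ≡.subst (λ j → IsMonic j (poly y)) 1+l∸l≡1 (poly-monic y) , e
        ; H₁-from = λ {y} my →
            let w , e = code (≡.subst (λ j → IsMonic j y) (≡.sym 1+l∸l≡1) my)
                h , h∈ , e' = L₀-divisors.surjective _≟C_
                  (ℕ.≤-trans (ℕ.≤-reflexive (≡.trans (length-codes (suc l ℕ.∸ l))
                    (≡.cong (q ^_) (≡.trans 1+l∸l≡1 (≡.sym m'≡1))))) q^m'≤H₁) (∈-codes w)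
            in h , h∈ , R.trans (*P-congˡ (poly h) (R.sym e)) e' }

    classification : LcmFamily ⊎ ExceptionalFamily
    classification with nondivisible-member
    ... | f₀ , f₀∈ with constant-or-distinct _≟C_ F₀ f₀∈
    ...   | inj₁ constant = inj₁ (lcmFamily f₀∈ constant)
    ...   | inj₂ (f , f' , f∈ , f'∈ , f≢f') with H₁-distinct
    ...     | h , h' , h∈ , h'∈ , h≢h' = inj₂ (exceptionalFamily h∈ h'∈ h≢h' f∈ f'∈ f≢f')

    -- Identification of the exceptional family.

    module _ (E : ExceptionalFamily) where
      open ExceptionalFamily E
      open Binary F q≡2
      private
        P≋ : P ≋ X²+X+1
        P≋ = quadratic-prime (≡.subst (λ k → IsPrime k P) (≡.cong suc m'≡1) P-prime)

        linear∣L : ∀ {y} → IsMonic 1 y → y ∣ L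
        linear∣L {y} my = let h , _ , e = H₁-from my in poly h , R.trans (R.*-comm y (poly h)) e

        L-cofactor : (X *P X+1) ∣ L
        L-cofactor = coprime-* X-coprime-X+1 (linear∣L X-monic) (linear∣L X+1-monic)

        -- What remains of `L` beyond X (X + 1). It divides every h, being part of L / X and of L /
        -- (X + 1), and hence every member; primarity then makes it 1.
        e : Poly
        e = _∣_.quotient L-cofactor

        XYe≋L : ((X *P X+1) *P e) ≋ L
        XYe≋L = _∣_.equality L-cofactor

        e-monic : IsMonic (suc l ℕ.∸ 2) e
        e-monic = monic-quotient (monic-* X-monic X+1-monic) (monic-resp (R.sym XYe≋L) L-monic)

        H₁-value : ∀ {h} → h ∈ H₁ → poly h ≋ (X+1 *P e) ⊎ poly h ≋ (X *P e)
        H₁-value {h} h∈ with H₁-to h∈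
        ... | y , my , hy≋L with linear my
        ...   | inj₁ y≋X = inj₁ (monic-cancel X-monic (begin
          (X *P poly h)      ≈⟨ R.*-comm X (poly h) ⟩
          (poly h *P X)      ≈⟨ *P-congˡ (poly h) y≋X ⟨
          (poly h *P y)      ≈⟨ hy≋L ⟩
          L                  ≈⟨ XYe≋L ⟨
          ((X *P X+1) *P e)  ≈⟨ R.*-assoc X X+1 e ⟩
          (X *P (X+1 *P e))  ∎))
        ...   | inj₂ y≋X+1 = inj₂ (monic-cancel X+1-monic (begin
          (X+1 *P poly h)    ≈⟨ R.*-comm X+1 (poly h) ⟩
          (poly h *P X+1)    ≈⟨ *P-congˡ (poly h) y≋X+1 ⟨
          (poly h *P y)      ≈⟨ hy≋L ⟩
          L                  ≈⟨ XYe≋L ⟨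
          ((X *P X+1) *P e)  ≈⟨ *P-congʳ (X *P X+1) (X+1 *P X) (R.*-comm X X+1) ⟩
          ((X+1 *P X) *P e)  ≈⟨ R.*-assoc X+1 X e ⟩
          (X+1 *P (X *P e))  ∎))

        e∣fam : ∀ {f} → f ∈ fam → e ∣ poly f
        e∣fam f∈ with member f∈
        ... | inj₁ f∈F₀ = let u , _ , f≋Lu = F₀-to f∈F₀ in
              ∣ˡ-respʳ-≈ (R.sym f≋Lu) (x∣ˡy⇒x∣ˡyz u (∣ˡ-respʳ-≈ XYe≋L (∣-*ˡ (X *P X+1) ∣ˡ-refl)))
        ... | inj₂ (h , h∈ , ≡.refl) = ∣ˡ-respʳ-≈ (R.sym (poly-multiple P-monic m+l≡n h)) (∣-*ˡ P (e∣h (H₁-value h∈)))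
          where
          e∣h : poly h ≋ (X+1 *P e) ⊎ poly h ≋ (X *P e) → e ∣ poly h
          e∣h (inj₁ h≋) = ∣ˡ-respʳ-≈ (R.sym h≋) (∣-*ˡ X+1 ∣ˡ-refl)
          e∣h (inj₂ h≋) = ∣ˡ-respʳ-≈ (R.sym h≋) (∣-*ˡ X ∣ˡ-refl)

        e-constant : suc l ℕ.∸ 2 ≡ 0
        e-constant with 1 ℕ.≤? suc l ℕ.∸ 2
        ... | no k≱1  = ℕ.n<1⇒n≡0 (ℕ.≰⇒> k≱1)
        ... | yes 1≤k = contradiction (λ {u} → e∣fam {u}) (primary 1≤k e-monic)

        e≋1 : e ≋ [ 1# ]
        e≋1 = monic-0⇒1 (≡.subst (λ k → IsMonic k e) e-constant e-monic)

        L≋ : L ≋ (X *P X+1)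
        L≋ = R.trans (R.sym XYe≋L) (R.trans (*P-congˡ (X *P X+1) e≋1) (R.*-identityʳ (X *P X+1)))

        H₁-value′ : ∀ {h} → h ∈ H₁ → poly h ≋ X+1 ⊎ poly h ≋ X
        H₁-value′ h∈ with H₁-value h∈
        ... | inj₁ h≋ = inj₁ (R.trans h≋ (R.trans (*P-congˡ X+1 e≋1) (R.*-identityʳ X+1)))
        ... | inj₂ h≋ = inj₂ (R.trans h≋ (R.trans (*P-congˡ X e≋1) (R.*-identityʳ X)))

        abb : ∀ a b → ((a *P b) *P b) ≋ (a *P (b *P b))
        abb a b = R.*-assoc a b b

        aba : ∀ a b → ((a *P b) *P a) ≋ ((a *P a) *P b)
        aba a b = R.trans (R.*-assoc a b a) (R.trans (*P-congˡ a (R.*-comm b a)) (R.sym (R.*-assoc a a b)))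

        L*X : (L *P X) ≋ ((X *P X) *P X+1)
        L*X = R.trans (*P-congʳ L (X *P X+1) L≋) (aba X X+1)

        L*X+1 : (L *P X+1) ≋ (X *P (X+1 *P X+1))
        L*X+1 = R.trans (*P-congʳ L (X *P X+1) L≋) (abb X X+1)

        P* : ∀ {h y} → h ≋ y → (P *P h) ≋ (y *P X²+X+1)
        P* {h} {y} h≋y = R.trans (*P-cong P≋ h≋y) (R.*-comm X²+X+1 y)

        quotient-member : ∀ {f h} y → h ∈ H₁ → poly h ≋ y → poly f ≋ (y *P X²+X+1) → f ∈ fam
        quotient-member {f} {h} y h∈ h≋y f≋ = ≡.subst (_∈ fam)
          (poly-injective (R.trans (poly-multiple P-monic m+l≡n h) (R.trans (P* h≋y) (R.sym f≋)))) (∈-H₁⁻ h∈)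

      -- The truncated difference l + 1 - 2, the degree of `e`, vanishes, so l ≤ 1.
      exceptional-l : l ≡ 1
      exceptional-l = ℕ.≤-antisym (ℕ.≤-pred (ℕ.m∸n≡0⇒m≤n e-constant)) 1≤l

      exceptional-n : n ≡ 3
      exceptional-n = ≡.trans (≡.sym l+m≡n) (≡.cong₂ (λ x y → x ℕ.+ suc y) exceptional-l m'≡1)

      -- With L = X (X + 1), the elements of `F₀` are L X and L (X + 1), and the remaining two are P
      -- times L / (X + 1) = X and P times L / X = X + 1.
      exceptional-to : ∀ {f} → f ∈ fam → Exceptional (poly f)
      exceptional-to f∈ with member f∈
      ... | inj₁ f∈F₀ = values (F₀-to f∈F₀)
        where
        values : ∀ {f} → (∃ λ u → IsMonic 1 u × f ≋ (L *P u)) → Exceptional f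
        values (u , mu , f≋Lu) with linear mu
        ... | inj₁ u≋X   = inj₁ (at (R.trans f≋Lu (R.trans (*P-congˡ L u≋X) L*X)))
        ... | inj₂ u≋X+1 = inj₂ (inj₁ (at (R.trans f≋Lu (R.trans (*P-congˡ L u≋X+1) L*X+1))))
      ... | inj₂ (h , h∈ , ≡.refl) with H₁-value′ h∈
      ...   | inj₁ h≋X+1 = inj₂ (inj₂ (inj₂ (at (R.trans (poly-multiple P-monic m+l≡n h) (P* h≋X+1)))))
      ...   | inj₂ h≋X   = inj₂ (inj₂ (inj₁ (at (R.trans (poly-multiple P-monic m+l≡n h) (P* h≋X)))))

      exceptional-from : ∀ {f} → Exceptional (poly f) → f ∈ fam
      exceptional-from (inj₁ e₁) =
        let f' , f'∈ , f'≋ = F₀-from X-monic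
        in ≡.subst (_∈ fam) (poly-injective (R.trans f'≋ (R.trans L*X (≋-sym (mk e₁))))) (proj₁ (∈-F₀⁻ f'∈))
      exceptional-from (inj₂ (inj₁ e₂)) =
        let f' , f'∈ , f'≋ = F₀-from X+1-monic
        in ≡.subst (_∈ fam) (poly-injective (R.trans f'≋ (R.trans L*X+1 (≋-sym (mk e₂))))) (proj₁ (∈-F₀⁻ f'∈))
      exceptional-from (inj₂ (inj₂ (inj₁ e₃))) =
        -- The element of `H₁` complementary to X + 1 in L is X.
        let h , h∈ , hy≋L = H₁-from X+1-monic
        in quotient-member X h∈ (monic-cancel X+1-monic (R.trans (R.*-comm X+1 (poly h))
             (R.trans hy≋L (R.trans L≋ (R.*-comm X X+1))))) (mk e₃)
      exceptional-from (inj₂ (inj₂ (inj₂ e₄))) =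
        let h , h∈ , hy≋L = H₁-from X-monic
        in quotient-member X+1 h∈ (monic-cancel X-monic (R.trans (R.*-comm X (poly h)) (R.trans hy≋L L≋))) (mk e₄)

-- From codes back to families of coefficient vectors.

module FamilyCodes {q : ℕ} {c ℓ : Level} (F : FiniteField q c ℓ) where
  open FiniteField F using (enum; trans; sym)
  open Poly F
  open PolyRing F
  open Degree F
  open Divisibility F
  open Codes F
  open PrimeExistence F using (prime-exists)
  open Extremal F
  private
    module R = CommutativeRing polyRing

  famCodes : ∀ {n} → List (Monic n) → List (Code n)
  famCodes = map encode

  encode-cong : ∀ {n} {f g : Monic n} → f ≈M g → encode f ≡ encode g
  encode-cong {f = f} {g} e = poly-injective (R.trans (poly-encode f) (R.trans (mk e) (R.sym (poly-encode g))))

  ∈F⇒∈ : ∀ {n} {f : Monic n} {Fam} → f ∈F Fam → encode f ∈ famCodes Fam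
  ∈F⇒∈ {f = f} f∈ = Any.map⁺ (Any.map (λ {g} → encode-cong {f = f} {g}) f∈)

  ∈⇒∈F : ∀ {n} {f : Monic n} {Fam w} → w ∈ famCodes Fam → poly w ≋ ⟦ f ⟧ → f ∈F Fam
  ∈⇒∈F w∈ e = Any.map (λ { {g} ≡.refl → at (R.trans (R.sym e) (poly-encode g)) }) (Any.map⁻ w∈)

  encode-∈⇒∈F : ∀ {n} {f : Monic n} {Fam} → encode f ∈ famCodes Fam → f ∈F Fam
  encode-∈⇒∈F {f = f} w∈ = ∈⇒∈F {f = f} w∈ (poly-encode f)

  famCodes-unique : ∀ {n} {Fam : List (Monic n)} → NoDup Fam → Unique (famCodes Fam)
  famCodes-unique nodup = AllPairs.map⁺ (AllPairs.map (λ {f} {g} f≉g e → f≉g (at (R.trans (R.sym (poly-encode f))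
    (R.trans (R.reflexive (≡.cong poly e)) (poly-encode g))))) nodup)

  module _ {n l : ℕ} {Fam : List (Monic n)} (nodup : NoDup Fam) (size : length Fam ≡ q ^ (n ∸ l))
           (intersecting : Intersecting l Fam) (primary : Primary Fam) where

    length-famCodes : length (famCodes Fam) ≡ q ^ (n ∸ l)
    length-famCodes = ≡.trans (List.length-map encode Fam) size

    common : ∀ {u v} → u ∈ famCodes Fam → v ∈ famCodes Fam →
             ∃₂ λ k g → l ≤ k × IsMonic k g × g ∣ poly u × g ∣ poly v
    common {u} {v} u∈ v∈ with intersecting (V.map enum u) (V.map enum v) (∈⇒∈F u∈ ≋-refl) (∈⇒∈F v∈ ≋-refl)
    ... | k , l≤k , g , g∣u , g∣v = k , ⟦ g ⟧ , l≤k , ⟦⟧-monic g , ∣P⇒∣ g∣u , ∣P⇒∣ g∣v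

    primary-codes : ∀ {k g} → 1 ≤ k → IsMonic k g → ¬ (∀ {u} → u ∈ famCodes Fam → g ∣ poly u)
    primary-codes {k} 1≤k mg g∣fam with toMonic k _ mg
    ... | v , v≋g = primary k 1≤k v λ f f∈ → ∣⇒∣P (∣ˡ-respˡ-≈ (R.sym v≋g) (∣ˡ-respʳ-≈ (poly-encode f) (g∣fam (∈F⇒∈ {f = f} f∈))))

    -- For l = 0 the prescribed size q^n is the number of all monic polynomials of degree n.
    everything : l ≡ 0 → ∀ f → f ∈F Fam
    everything ≡.refl f = encode-∈⇒∈F {f = f} (unique-⊆-full _≟C_ (famCodes-unique nodup) (λ {w} _ → ∈-codes w)
      (ℕ.≤-reflexive (≡.trans (length-codes n) (≡.sym length-famCodes))) (∈-codes (encode f)))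

    trivial : l ≡ 0 → Trivial l Fam
    -- The empty vector stands for the constant polynomial 1.
    trivial ≡.refl = [] , λ f →
      (λ _ → f , at (R.*-identityˡ ⟦ f ⟧)) , λ _ → everything ≡.refl f

    -- For n = l the family has q^0 = 1 member, a polynomial of positive degree which divides the
    -- whole family, against primarity.
    singleton-impossible : 1 ≤ l → l ≤ n → ¬ n ∸ l ≡ 0
    singleton-impossible 1≤l l≤n m≡0 with famCodes Fam in eq
    ... | w ∷ [] = primary-codes (ℕ.≤-trans 1≤l l≤n) (poly-monic w) λ u∈ →
                     ∣ˡ-reflexive (R.reflexive (≡.cong poly (only (≡.subst (_ ∈_) eq u∈))))
      where
      only : ∀ {u} → u ∈ w ∷ [] → w ≡ u
      only (here ≡.refl) = ≡.refl
    ... | [] = contradiction (≡.trans (≡.sym (≡.cong length eq)) (≡.trans length-famCodes (≡.cong (q ^_) m≡0))) λ ()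
    ... | _ ∷ _ ∷ _ = contradiction (≡.trans (≡.sym (≡.cong length eq)) (≡.trans length-famCodes (≡.cong (q ^_) m≡0))) λ ()

    -- The codimension `m` is a separate argument with an equation, so that it can be split into
    -- zero and successor.
    conclusion : 1 ≤ l → l ≤ n → ∀ m → n ∸ l ≡ m →
      (q ≡ 2 × l ≡ 1 × n ≡ 3 × Fam ≐ (λ f → Exceptional ⟦ f ⟧)) ⊎ (∃ λ d → 1 ≤ d × IsFd d Fam)
    conclusion 1≤l l≤n zero     m≡ = contradiction m≡ (singleton-impossible 1≤l l≤n)
    conclusion 1≤l l≤n (suc m') m≡ = cases (proj₁ (prime-exists m')) (proj₂ (prime-exists m'))
      where
      l+m≡n : l ℕ.+ suc m' ≡ n
      l+m≡n = ≡.trans (≡.cong (l ℕ.+_) (≡.sym m≡)) (ℕ.m+[n∸m]≡n l≤n)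
      cases : (Pc : Code (suc m')) → IsPrime (suc m') (poly Pc) →
        (q ≡ 2 × l ≡ 1 × n ≡ 3 × Fam ≐ (λ f → Exceptional ⟦ f ⟧)) ⊎ (∃ λ d → 1 ≤ d × IsFd d Fam)
      cases Pc pP = convert classification
        where
        open Family Pc pP l+m≡n 1≤l (famCodes Fam) (famCodes-unique nodup)
          (≡.trans length-famCodes (≡.cong (q ^_) m≡)) common primary-codes
        convert : LcmFamily ⊎ ExceptionalFamily →
          (q ≡ 2 × l ≡ 1 × n ≡ 3 × Fam ≐ (λ f → Exceptional ⟦ f ⟧)) ⊎ (∃ λ d → 1 ≤ d × IsFd d Fam)
        convert (inj₂ E) = inj₁ (ExceptionalFamily.q≡2 E , exceptional-l E , exceptional-n E , λ f →
          (λ f∈ → exceptional-resp (poly-encode f) (exceptional-to E (∈F⇒∈ {f = f} f∈))) ,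
          (λ ex → encode-∈⇒∈F {f = f} (exceptional-from E (exceptional-resp (R.sym (poly-encode f)) ex))))
          where
          exceptional-resp : ∀ {f g} → f ≋ g → Exceptional f → Exceptional g
          exceptional-resp e (inj₁ x)               = inj₁ (λ i → trans (sym (at e i)) (x i))
          exceptional-resp e (inj₂ (inj₁ x))        = inj₂ (inj₁ ((λ i → trans (sym (at e i)) (x i))))
          exceptional-resp e (inj₂ (inj₂ (inj₁ x))) = inj₂ (inj₂ (inj₁ ((λ i → trans (sym (at e i)) (x i)))))
          exceptional-resp e (inj₂ (inj₂ (inj₂ x))) = inj₂ (inj₂ (inj₂ ((λ i → trans (sym (at e i)) (x i)))))
        convert (inj₁ lcm) with toMonic _ _ (LcmFamily.H-monic lcm)
        -- The integer d of the theorem is m = n - l.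
        ... | H' , H'≋H = inj₂ (suc m' , s≤s z≤n , _ , H' , (common-∣ , least) , λ f → to f , from f)
          where
          open LcmFamily lcm
          common-∣ : ∀ p → ⟦ p ⟧ ∣P ⟦ H' ⟧
          common-∣ p = ∣⇒∣P (∣ˡ-respˡ-≈ (poly-encode p) (∣ˡ-respʳ-≈ (R.sym H'≋H) (H-common (encode p))))
          least : ∀ M → (∀ p → ⟦ p ⟧ ∣P M) → ⟦ H' ⟧ ∣P M
          least M p∣M = ∣⇒∣P (∣ˡ-respˡ-≈ (R.sym H'≋H) (H-least M λ p → ∣P⇒∣ (p∣M (V.map enum p))))
          to : ∀ f → f ∈F Fam → Σ (Monic (suc m')) λ p → (⟦ p ⟧ *P ⟦ f ⟧) ≈P ⟦ H' ⟧
          to f f∈ = let p , e = quotient (∈F⇒∈ {f = f} f∈) in V.map enum p ,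
            at (R.trans (*P-congˡ (poly p) (R.sym (poly-encode f))) (R.trans e (R.sym H'≋H)))
          from : ∀ f → (Σ (Monic (suc m')) λ p → (⟦ p ⟧ *P ⟦ f ⟧) ≈P ⟦ H' ⟧) → f ∈F Fam
          from f (p , e) = encode-∈⇒∈F {f = f} (quotient⁻ (encode p)
            (R.trans (*P-cong (poly-encode p) (poly-encode f)) (R.trans (mk e) H'≋H)))

theorem3 : ∀ {c ℓ : Level} (q : ℕ) (F : FiniteField q c ℓ) → let open Poly F in
    (n l : ℕ) → l ≤ n → (Fam : List (Monic n)) →
    NoDup Fam → length Fam ≡ q ^ (n ∸ l) →
    Intersecting l Fam → Primary Fam → ¬ Trivial l Fam →
    (q ≡ 2 × l ≡ 1 × n ≡ 3 × Fam ≐ (λ f → Exceptional ⟦ f ⟧))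
    ⊎ (∃ λ d → 1 ≤ d × IsFd d Fam)
theorem3 q F n zero l≤n Fam nodup size intersecting primary nontrivial =
  contradiction (FamilyCodes.trivial F nodup size intersecting primary ≡.refl) nontrivial
theorem3 q F n (suc l) l≤n Fam nodup size intersecting primary nontrivial =
  FamilyCodes.conclusion F nodup size intersecting primary (s≤s z≤n) l≤n (n ∸ suc l) ≡.refl
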